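{- Let $\Gamma$ be a weighted digraph with Kirchhoff matrix $L$, let $\tau>0$, and consider any Markov chain related to $\Gamma$, i.e. any homogeneous Markov chain on $\{1,\dots,n\}$ whose transition probability matrix is $P=I-\alpha L$ for some $\alpha>0$. Put $$q=\left(\frac{\tau}{\alpha}+1\right)^{ -1}.$$ Then $$Q(\tau)=\widetilde P(\alpha,q),$$ where $Q(\tau)=(I+\tau L)^{ -1}$ is the normalized matrix of out forests and $\widetilde P(\alpha,q)$ is the transition matrix of the chain in the geometric model of random observation with success probability $q$.
   Context: $\Gamma$ is a weighted digraph without loops with vertex set $V(\Gamma)=\{1,\dots,n\}$, $n>1$; all arcs have strictly positive real weights; $\varepsilon_{ij}$ denotes the weight of the arc from $i$ to $j$, with $\varepsilon_{ij}=0$ if and only if there is no such arc. The Kirchhoff matrix $L=L(\Gamma)=(\ell_{ij})$ is the $n\times n$ matrix with $\ell_{ij}=-\varepsilon_{ji}$ for $j\ne i$ and $\ell_{ii}=-\sum_{k\ne i}\ell_{ik}$. For $\tau>0$, $I+\tau L$ is invertible, and $Q(\tau)=(I+\tau L)^{ -1}$ is called the normalized matrix of out forests. A homogeneous Markov chain with states $\{1,\dots,n\}$ and (row-stochastic) transition probability matrix $P$, whose $(i,j)$ entry is the probability of going from $i$ to $j$, is related to $\Gamma$ if $P=I-\alpha L(\Gamma)$ for some $\alpha\neq 0$. Geometric model of random observation with success probability $q\in(0,1)$: independently of the chain, Bernoulli trials with success probability $q$ are performed at times $t=0,1,2,\dots$ until the first success; the time $T$ of the first success is the epoch of observation, so that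 $\Pr(T=k)=q(1-q)^k$, $k=0,1,2,\dots$. The matrix $\widetilde P(\alpha,q)=(\widetilde p_{ij}(\alpha,q))$ is the matrix of unconditional transition probabilities from the initial state (at $t=0$) to the state at the random epoch $T$: $\widetilde p_{ij}(\alpha,q)$ is the probability that the chain started in state $i$ is in state $j$ at time $T$. -}

module Defs where

open import Algebra.Bundles.Raw using (RawRing)
import Algebra.Definitions.RawSemiring as RawSemiringDefs
open import Data.Bool.Base using (if_then_else_)
open import Data.Fin.Base using (Fin; toℕ)
import Data.Fin.Properties as Fin
open import Data.Nat.Base as ℕ using (ℕ; zero; suc)
import Data.Nat.Properties as ℕ
open import Data.Product.Base using (∃-syntax; _×_; _,_; Σ; proj₁; proj₂)
open import Data.Rational.Base as ℚ using (ℚ; 0ℚ; 1ℚ; ½; ∣_∣)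
import Data.Rational.Properties as ℚ
open import Data.Rational.Solver using (module +-*-Solver)
open import Data.Sum.Base using (inj₁; inj₂)
open import Data.Vec.Base using (Vec; []; _∷_; head; last)
open import Level using (0ℓ)
open import Relation.Binary.PropositionalEquality
  using (_≡_; refl; sym; trans; cong; cong₂; subst; subst₂)
open import Relation.Nullary using (¬_; yes; no; does; contradiction)
open import Relation.Nullary.Decidable.Core using (Dec)
open import Relation.Unary using (Pred; Decidable)

open +-*-Solver using (solve; _:+_; _:*_; _:-_; :-_; _:=_; con)

-- The real numbers: Cauchy sequences of rationals, with the setoid
-- equality _≈_ (difference tending to 0).

Eventually : Pred ℕ 0ℓ → Set
Eventually P = ∃[ N ] (∀ n → N ℕ.≤ n → P n)

IsCauchy : (ℕ → ℚ) → Set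
IsCauchy x = ∀ ε → 0ℚ ℚ.< ε →
  ∃[ N ] (∀ m n → N ℕ.≤ m → N ℕ.≤ n → ∣ x m ℚ.- x n ∣ ℚ.< ε)

record ℝ : Set where
  constructor real
  field
    seq    : ℕ → ℚ
    cauchy : IsCauchy seq

open ℝ public

infix 4 _≈_ _<_ _≤_

_≈_ : ℝ → ℝ → Set
x ≈ y = ∀ ε → 0ℚ ℚ.< ε → Eventually (λ n → ∣ seq x n ℚ.- seq y n ∣ ℚ.< ε)

_<_ : ℝ → ℝ → Set
x < y = ∃[ ε ] 0ℚ ℚ.< ε × Eventually (λ n → seq x n ℚ.+ ε ℚ.≤ seq y n)

_≤_ : ℝ → ℝ → Set
x ≤ y = ∀ ε → 0ℚ ℚ.< ε → Eventually (λ n → seq x n ℚ.≤ seq y n ℚ.+ ε)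

both : ∀ {P Q : Pred ℕ 0ℓ} → Eventually P → Eventually Q →
       Eventually (λ n → P n × Q n)
both (M , p) (N , q) = M ℕ.⊔ N , λ n h →
  p n (ℕ.≤-trans (ℕ.m≤m⊔n M N) h) , q n (ℕ.≤-trans (ℕ.m≤n⊔m M N) h)

0<+ : ∀ {p q} → 0ℚ ℚ.< p → 0ℚ ℚ.< q → 0ℚ ℚ.< p ℚ.+ q
0<+ {p} {q} 0<p 0<q = subst (ℚ._< p ℚ.+ q) (ℚ.+-identityˡ 0ℚ) (ℚ.+-mono-< 0<p 0<q)

0<* : ∀ {p q} → 0ℚ ℚ.< p → 0ℚ ℚ.< q → 0ℚ ℚ.< p ℚ.* q
0<* {p} {q} 0<p 0<q =
  subst (ℚ._< p ℚ.* q) (ℚ.*-zeroʳ p)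
    (ℚ.*-monoʳ-<-pos p {{ℚ.positive 0<p}} 0<q)

0<½ : 0ℚ ℚ.< ½
0<½ = ℚ.positive⁻¹ ½

0<1 : 0ℚ ℚ.< 1ℚ
0<1 = ℚ.positive⁻¹ 1ℚ

halves : ∀ p → p ℚ.* ½ ℚ.+ p ℚ.* ½ ≡ p
halves p = trans (sym (ℚ.*-distribˡ-+ p ½ ½)) (ℚ.*-identityʳ p)

*-mono-≤ : ∀ {a b c d} → 0ℚ ℚ.≤ b → 0ℚ ℚ.≤ c → a ℚ.≤ b → c ℚ.≤ d →
           a ℚ.* c ℚ.≤ b ℚ.* d
*-mono-≤ {a} {b} {c} {d} 0≤b 0≤c a≤b c≤d = ℚ.≤-trans
  (ℚ.*-monoʳ-≤-nonNeg c {{ℚ.nonNegative 0≤c}} a≤b)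
  (ℚ.*-monoˡ-≤-nonNeg b {{ℚ.nonNegative 0≤b}} c≤d)

p≤∣p∣ : ∀ p → p ℚ.≤ ∣ p ∣
p≤∣p∣ p with ℚ.≤-total 0ℚ p
... | inj₁ 0≤p = ℚ.≤-reflexive (sym (ℚ.0≤p⇒∣p∣≡p 0≤p))
... | inj₂ p≤0 = ℚ.≤-trans p≤0 (ℚ.0≤∣p∣ p)

bounded : ∀ {x} → IsCauchy x →
          ∃[ B ] 0ℚ ℚ.< B × Eventually (λ n → ∣ x n ∣ ℚ.≤ B)
bounded {x} cx with cx 1ℚ 0<1
... | N , h =
  ∣ x N ∣ ℚ.+ 1ℚ
  , ℚ.<-≤-trans 0<1 (ℚ.+-monoˡ-≤ 1ℚ (ℚ.0≤∣p∣ (x N)))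
  , N , λ n N≤n → begin
    ∣ x n ∣                      ≡⟨ cong ∣_∣ (solve 2 (λ a b → a := b :+ (a :- b)) refl (x n) (x N)) ⟩
    ∣ x N ℚ.+ (x n ℚ.- x N) ∣    ≤⟨ ℚ.∣p+q∣≤∣p∣+∣q∣ (x N) (x n ℚ.- x N) ⟩
    ∣ x N ∣ ℚ.+ ∣ x n ℚ.- x N ∣  ≤⟨ ℚ.+-monoʳ-≤ ∣ x N ∣ (ℚ.<⇒≤ (h n N N≤n ℕ.≤-refl)) ⟩
    ∣ x N ∣ ℚ.+ 1ℚ               ∎
  where open ℚ.≤-Reasoning

fromℚ : ℚ → ℝ
fromℚ p = real (λ _ → p) λ ε 0<ε → 0 , λ _ _ _ _ →
  subst (λ d → ∣ d ∣ ℚ.< ε) (sym (ℚ.+-inverseʳ p)) 0<ε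

0ℝ 1ℝ : ℝ
0ℝ = fromℚ 0ℚ
1ℝ = fromℚ 1ℚ

infixl 6 _+_ _-_
infixl 7 _*_
infix  8 -_

_+_ : ℝ → ℝ → ℝ
real x cx + real y cy = real (λ n → x n ℚ.+ y n) cauchy-+
  where
  open ℚ.≤-Reasoning
  cauchy-+ : IsCauchy (λ n → x n ℚ.+ y n)
  cauchy-+ ε 0<ε =
    let
      M , hx = cx (ε ℚ.* ½) (0<* 0<ε 0<½)
      N , hy = cy (ε ℚ.* ½) (0<* 0<ε 0<½)
    in M ℕ.⊔ N , λ m n hm hn → begin-strict
    ∣ (x m ℚ.+ y m) ℚ.- (x n ℚ.+ y n) ∣
      ≡⟨ cong ∣_∣ (solve 4 (λ a b c d → (a :+ b) :- (c :+ d) := (a :- c) :+ (b :- d))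
                     refl (x m) (y m) (x n) (y n)) ⟩
    ∣ (x m ℚ.- x n) ℚ.+ (y m ℚ.- y n) ∣
      ≤⟨ ℚ.∣p+q∣≤∣p∣+∣q∣ (x m ℚ.- x n) (y m ℚ.- y n) ⟩
    ∣ x m ℚ.- x n ∣ ℚ.+ ∣ y m ℚ.- y n ∣
      <⟨ ℚ.+-mono-<
           (hx m n (ℕ.≤-trans (ℕ.m≤m⊔n M N) hm) (ℕ.≤-trans (ℕ.m≤m⊔n M N) hn))
           (hy m n (ℕ.≤-trans (ℕ.m≤n⊔m M N) hm) (ℕ.≤-trans (ℕ.m≤n⊔m M N) hn)) ⟩
    ε ℚ.* ½ ℚ.+ ε ℚ.* ½
      ≡⟨ halves ε ⟩
    ε ∎

-_ : ℝ → ℝ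
- real x cx = real (λ n → ℚ.- x n) λ ε 0<ε →
  let N , h = cx ε 0<ε in N , λ m n hm hn →
  subst (ℚ._< ε)
    (trans (sym (ℚ.∣-p∣≡∣p∣ (x m ℚ.- x n)))
      (cong ∣_∣ (solve 2 (λ a b → :- (a :- b) := (:- a) :- (:- b)) refl (x m) (x n))))
    (h m n hm hn)

_-_ : ℝ → ℝ → ℝ
x - y = x + (- y)

scale : ∀ {p q} → 0ℚ ℚ.< p → 0ℚ ℚ.< q → ∃[ r ] 0ℚ ℚ.< r × p ℚ.* r ≡ q
scale {p} {q} 0<p 0<q = r ℚ.* q , 0<* (ℚ.positive⁻¹ r {{ℚ.1/pos⇒pos p {{ℚ.positive 0<p}}}}) 0<q ,
  trans (sym (ℚ.*-assoc p r q))
    (trans (cong (ℚ._* q) (ℚ.*-inverseʳ p {{ℚ.>-nonZero 0<p}})) (ℚ.*-identityˡ q))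
  where
  r : ℚ
  r = (ℚ.1/ p) {{ℚ.>-nonZero 0<p}}

*-close : ∀ {A B η θ} → 0ℚ ℚ.< A → 0ℚ ℚ.< B → ∀ a b c d →
          ∣ a ∣ ℚ.≤ A → ∣ d ∣ ℚ.≤ B → ∣ b ℚ.- d ∣ ℚ.< η → ∣ a ℚ.- c ∣ ℚ.< θ →
          ∣ a ℚ.* b ℚ.- c ℚ.* d ∣ ℚ.< A ℚ.* η ℚ.+ B ℚ.* θ
*-close {A} {B} {η} {θ} 0<A 0<B a b c d a≤A d≤B bd<η ac<θ = begin-strict
  ∣ a ℚ.* b ℚ.- c ℚ.* d ∣
    ≡⟨ cong ∣_∣ (solve 4 (λ a b c d → a :* b :- c :* d := a :* (b :- d) :+ d :* (a :- c))
                   refl a b c d) ⟩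
  ∣ a ℚ.* (b ℚ.- d) ℚ.+ d ℚ.* (a ℚ.- c) ∣
    ≤⟨ ℚ.∣p+q∣≤∣p∣+∣q∣ (a ℚ.* (b ℚ.- d)) (d ℚ.* (a ℚ.- c)) ⟩
  ∣ a ℚ.* (b ℚ.- d) ∣ ℚ.+ ∣ d ℚ.* (a ℚ.- c) ∣
    ≡⟨ cong₂ ℚ._+_ (ℚ.∣p*q∣≡∣p∣*∣q∣ a (b ℚ.- d)) (ℚ.∣p*q∣≡∣p∣*∣q∣ d (a ℚ.- c)) ⟩
  ∣ a ∣ ℚ.* ∣ b ℚ.- d ∣ ℚ.+ ∣ d ∣ ℚ.* ∣ a ℚ.- c ∣
    ≤⟨ ℚ.+-mono-≤
         (ℚ.*-monoʳ-≤-nonNeg ∣ b ℚ.- d ∣ {{ℚ.∣-∣-nonNeg (b ℚ.- d)}} a≤A)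
         (ℚ.*-monoʳ-≤-nonNeg ∣ a ℚ.- c ∣ {{ℚ.∣-∣-nonNeg (a ℚ.- c)}} d≤B) ⟩
  A ℚ.* ∣ b ℚ.- d ∣ ℚ.+ B ℚ.* ∣ a ℚ.- c ∣
    <⟨ ℚ.+-mono-< (ℚ.*-monoʳ-<-pos A {{ℚ.positive 0<A}} bd<η)
                  (ℚ.*-monoʳ-<-pos B {{ℚ.positive 0<B}} ac<θ) ⟩
  A ℚ.* η ℚ.+ B ℚ.* θ ∎
  where open ℚ.≤-Reasoning

_*_ : ℝ → ℝ → ℝ
real x cx * real y cy = real (λ n → x n ℚ.* y n) cauchy-*
  where
  cauchy-* : IsCauchy (λ n → x n ℚ.* y n)
  cauchy-* ε 0<ε =
    let
      A , 0<A , K , hA = bounded cx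
      B , 0<B , L , hB = bounded cy
      η , 0<η , Aη≡ε/2 = scale 0<A (0<* 0<ε 0<½)
      θ , 0<θ , Bθ≡ε/2 = scale 0<B (0<* 0<ε 0<½)
      M , hy = cy η 0<η
      N , hx = cx θ 0<θ
    in (K ℕ.⊔ L) ℕ.⊔ (M ℕ.⊔ N) , λ m n hm hn →
    let
      KL≤m = ℕ.≤-trans (ℕ.m≤m⊔n (K ℕ.⊔ L) (M ℕ.⊔ N)) hm
      KL≤n = ℕ.≤-trans (ℕ.m≤m⊔n (K ℕ.⊔ L) (M ℕ.⊔ N)) hn
      MN≤m = ℕ.≤-trans (ℕ.m≤n⊔m (K ℕ.⊔ L) (M ℕ.⊔ N)) hm
      MN≤n = ℕ.≤-trans (ℕ.m≤n⊔m (K ℕ.⊔ L) (M ℕ.⊔ N)) hn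
    in subst (∣ x m ℚ.* y m ℚ.- x n ℚ.* y n ∣ ℚ.<_)
      (trans (cong₂ ℚ._+_ Aη≡ε/2 Bθ≡ε/2) (halves ε))
      (*-close 0<A 0<B (x m) (y m) (x n) (y n)
        (hA m (ℕ.≤-trans (ℕ.m≤m⊔n K L) KL≤m))
        (hB n (ℕ.≤-trans (ℕ.m≤n⊔m K L) KL≤n))
        (hy m n (ℕ.≤-trans (ℕ.m≤m⊔n M N) MN≤m) (ℕ.≤-trans (ℕ.m≤m⊔n M N) MN≤n))
        (hx m n (ℕ.≤-trans (ℕ.m≤n⊔m M N) MN≤m) (ℕ.≤-trans (ℕ.m≤n⊔m M N) MN≤n)))

-- The junk value at 0 is irrelevant: it affects only finitely many terms
-- of the reciprocal of a positive real.
recip : ℚ → ℚ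
recip p with p ℚ.≟ 0ℚ
... | yes _  = 0ℚ
... | no p≢0 = (ℚ.1/ p) {{ℚ.≢-nonZero p≢0}}

*-recip : ∀ {p} → 0ℚ ℚ.< p → p ℚ.* recip p ≡ 1ℚ
*-recip {p} 0<p with p ℚ.≟ 0ℚ
... | yes p≡0 = contradiction (sym p≡0) (ℚ.<⇒≢ 0<p)
... | no p≢0  = ℚ.*-inverseʳ p {{ℚ.≢-nonZero p≢0}}

recip-pos : ∀ {p} → 0ℚ ℚ.< p → 0ℚ ℚ.< recip p
recip-pos {p} 0<p = ℚ.*-cancelˡ-<-nonNeg p {{ℚ.nonNegative (ℚ.<⇒≤ 0<p)}}
  (subst₂ ℚ._<_ (sym (ℚ.*-zeroʳ p)) (sym (*-recip 0<p)) 0<1)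

recip-close : ∀ {δ ε a b} → 0ℚ ℚ.< δ → δ ℚ.≤ a → δ ℚ.≤ b →
              ∣ b ℚ.- a ∣ ℚ.< ε ℚ.* (δ ℚ.* δ) → ∣ recip a ℚ.- recip b ∣ ℚ.< ε
recip-close {δ} {ε} {a} {b} 0<δ δ≤a δ≤b b-a<εδ² = ℚ.*-cancelʳ-<-nonNeg (δ ℚ.* δ)
  {{ℚ.nonNegative (ℚ.<⇒≤ (0<* 0<δ 0<δ))}} (close (recip a) (recip b) (*-recip 0<a) (*-recip 0<b))
  where
  open ℚ.≤-Reasoning
  0<a : 0ℚ ℚ.< a
  0<a = ℚ.<-≤-trans 0<δ δ≤a
  0<b : 0ℚ ℚ.< b
  0<b = ℚ.<-≤-trans 0<δ δ≤b
  close : ∀ r s → a ℚ.* r ≡ 1ℚ → b ℚ.* s ≡ 1ℚ →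
          ∣ r ℚ.- s ∣ ℚ.* (δ ℚ.* δ) ℚ.< ε ℚ.* (δ ℚ.* δ)
  close r s ar≡1 bs≡1 = begin-strict
    ∣ r ℚ.- s ∣ ℚ.* (δ ℚ.* δ)
      ≤⟨ ℚ.*-monoˡ-≤-nonNeg ∣ r ℚ.- s ∣ {{ℚ.∣-∣-nonNeg (r ℚ.- s)}}
           (*-mono-≤ (ℚ.<⇒≤ 0<b) (ℚ.<⇒≤ 0<δ) δ≤b δ≤a) ⟩
    ∣ r ℚ.- s ∣ ℚ.* (b ℚ.* a)
      ≡⟨ cong (∣ r ℚ.- s ∣ ℚ.*_) (ℚ.0≤p⇒∣p∣≡p (ℚ.<⇒≤ (0<* 0<b 0<a))) ⟨
    ∣ r ℚ.- s ∣ ℚ.* ∣ b ℚ.* a ∣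
      ≡⟨ ℚ.∣p*q∣≡∣p∣*∣q∣ (r ℚ.- s) (b ℚ.* a) ⟨
    ∣ (r ℚ.- s) ℚ.* (b ℚ.* a) ∣
      ≡⟨ cong ∣_∣ (solve 4 (λ a b r s → (r :- s) :* (b :* a) := b :* (a :* r) :- a :* (b :* s))
                     refl a b r s) ⟩
    ∣ b ℚ.* (a ℚ.* r) ℚ.- a ℚ.* (b ℚ.* s) ∣
      ≡⟨ cong₂ (λ u v → ∣ b ℚ.* u ℚ.- a ℚ.* v ∣) ar≡1 bs≡1 ⟩
    ∣ b ℚ.* 1ℚ ℚ.- a ℚ.* 1ℚ ∣
      ≡⟨ cong₂ (λ u v → ∣ u ℚ.- v ∣) (ℚ.*-identityʳ b) (ℚ.*-identityʳ a) ⟩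
    ∣ b ℚ.- a ∣
      <⟨ b-a<εδ² ⟩
    ε ℚ.* (δ ℚ.* δ) ∎

infix 9 _⁻¹⟨_⟩

_⁻¹⟨_⟩ : (x : ℝ) → 0ℝ < x → ℝ
real x cx ⁻¹⟨ δ , 0<δ , K , δ≤x ⟩ = real (λ n → recip (x n)) cauchy-recip
  where
  x≥δ : ∀ n → K ℕ.≤ n → δ ℚ.≤ x n
  x≥δ n K≤n = subst (ℚ._≤ x n) (ℚ.+-identityˡ δ) (δ≤x n K≤n)
  cauchy-recip : IsCauchy (λ n → recip (x n))
  cauchy-recip ε 0<ε =
    let N , hx = cx (ε ℚ.* (δ ℚ.* δ)) (0<* 0<ε (0<* 0<δ 0<δ)) in K ℕ.⊔ N , λ m n hm hn → recip-close 0<δ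
    (x≥δ m (ℕ.≤-trans (ℕ.m≤m⊔n K N) hm))
    (x≥δ n (ℕ.≤-trans (ℕ.m≤m⊔n K N) hn))
    (hx n m (ℕ.≤-trans (ℕ.m≤n⊔m K N) hn) (ℕ.≤-trans (ℕ.m≤n⊔m K N) hm))

infixl 7 _/_⟨_⟩

_/_⟨_⟩ : ℝ → (y : ℝ) → 0ℝ < y → ℝ
x / y ⟨ 0<y ⟩ = x * y ⁻¹⟨ 0<y ⟩

pos : ∀ {x δ} → 0ℚ ℚ.< δ → Eventually (λ n → δ ℚ.≤ seq x n) → 0ℝ < x
pos {x} {δ} 0<δ (N , h) = δ , 0<δ , N , λ n N≤n →
  subst (ℚ._≤ seq x n) (sym (ℚ.+-identityˡ δ)) (h n N≤n)

pos⁻¹ : ∀ {x} ((δ , _) : 0ℝ < x) → Eventually (λ n → δ ℚ.≤ seq x n)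
pos⁻¹ {x} (δ , _ , N , h) = N , λ n N≤n →
  subst (ℚ._≤ seq x n) (ℚ.+-identityˡ δ) (h n N≤n)

*-pos : ∀ {x y} → 0ℝ < x → 0ℝ < y → 0ℝ < x * y
*-pos {x} {y} 0<x@(δ , 0<δ , _) 0<y@(η , 0<η , _) =
  let N , h = both (pos⁻¹ {x} 0<x) (pos⁻¹ {y} 0<y) in
  pos {x * y} (0<* 0<δ 0<η) (N , λ n N≤n →
  let hx , hy = h n N≤n in
  *-mono-≤ (ℚ.<⇒≤ (ℚ.<-≤-trans 0<δ hx)) (ℚ.<⇒≤ 0<η) hx hy)

recip-antimono : ∀ {p q} → 0ℚ ℚ.< p → p ℚ.≤ q → recip q ℚ.≤ recip p
recip-antimono {p} {q} 0<p p≤q = ℚ.*-cancelˡ-≤-pos q {{ℚ.positive 0<q}} (begin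
  q ℚ.* recip q  ≡⟨ *-recip 0<q ⟩
  1ℚ             ≡⟨ *-recip 0<p ⟨
  p ℚ.* recip p  ≤⟨ ℚ.*-monoʳ-≤-nonNeg (recip p) {{ℚ.nonNegative (ℚ.<⇒≤ (recip-pos 0<p))}} p≤q ⟩
  q ℚ.* recip p  ∎)
  where
  open ℚ.≤-Reasoning
  0<q : 0ℚ ℚ.< q
  0<q = ℚ.<-≤-trans 0<p p≤q

⁻¹-pos : ∀ {x} (0<x : 0ℝ < x) → 0ℝ < x ⁻¹⟨ 0<x ⟩
⁻¹-pos {x} 0<x@(δ , 0<δ , _) =
  let
    B , 0<B , bnd = bounded (cauchy x)
    N , h = both (pos⁻¹ {x} 0<x) bnd
  in pos {x ⁻¹⟨ 0<x ⟩} (recip-pos 0<B) (N , λ n N≤n →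
  let δ≤x , ∣x∣≤B = h n N≤n in
  recip-antimono (ℚ.<-≤-trans 0<δ δ≤x) (ℚ.≤-trans (p≤∣p∣ (seq x n)) ∣x∣≤B))

<+1 : ∀ {x} → 0ℝ < x → 1ℝ < x + 1ℝ
<+1 {x} 0<x@(δ , 0<δ , _) = let N , h = pos⁻¹ {x} 0<x in
  δ , 0<δ , N , λ n N≤n →
  subst (ℚ._≤ seq x n ℚ.+ 1ℚ) (ℚ.+-comm δ 1ℚ) (ℚ.+-monoˡ-≤ 1ℚ (h n N≤n))

1<⇒0< : ∀ {x} → 1ℝ < x → 0ℝ < x
1<⇒0< (δ , 0<δ , N , h) = δ , 0<δ , N , λ n N≤n →
  ℚ.≤-trans (ℚ.+-monoˡ-≤ δ (ℚ.<⇒≤ 0<1)) (h n N≤n)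

recip-<1 : ∀ {δ y B} → 0ℚ ℚ.< δ → 1ℚ ℚ.+ δ ℚ.≤ y → y ℚ.≤ B →
           recip y ℚ.+ δ ℚ.* recip B ℚ.≤ 1ℚ
recip-<1 {δ} {y} {B} 0<δ 1+δ≤y y≤B =
  ℚ.*-cancelˡ-≤-pos y {{ℚ.positive 0<y}} (scaled (recip y) (recip B) (*-recip 0<y) (*-recip 0<B) (recip-pos 0<B))
  where
  open ℚ.≤-Reasoning
  0<y : 0ℚ ℚ.< y
  0<y = ℚ.<-≤-trans (0<+ 0<1 0<δ) 1+δ≤y
  0<B : 0ℚ ℚ.< B
  0<B = ℚ.<-≤-trans 0<y y≤B
  scaled : ∀ r s → y ℚ.* r ≡ 1ℚ → B ℚ.* s ≡ 1ℚ → 0ℚ ℚ.< s →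
           y ℚ.* (r ℚ.+ δ ℚ.* s) ℚ.≤ y ℚ.* 1ℚ
  scaled r s yr≡1 Bs≡1 0<s = begin
    y ℚ.* (r ℚ.+ δ ℚ.* s)        ≡⟨ ℚ.*-distribˡ-+ y r (δ ℚ.* s) ⟩
    y ℚ.* r ℚ.+ y ℚ.* (δ ℚ.* s)  ≡⟨ cong (ℚ._+ y ℚ.* (δ ℚ.* s)) yr≡1 ⟩
    1ℚ ℚ.+ y ℚ.* (δ ℚ.* s)
      ≤⟨ ℚ.+-monoʳ-≤ 1ℚ (ℚ.*-monoʳ-≤-nonNeg (δ ℚ.* s)
           {{ℚ.nonNegative (ℚ.<⇒≤ (0<* 0<δ 0<s))}} y≤B) ⟩
    1ℚ ℚ.+ B ℚ.* (δ ℚ.* s)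
      ≡⟨ cong (1ℚ ℚ.+_) (solve 3 (λ b d s → b :* (d :* s) := d :* (b :* s)) refl B δ s) ⟩
    1ℚ ℚ.+ δ ℚ.* (B ℚ.* s)       ≡⟨ cong (λ u → 1ℚ ℚ.+ δ ℚ.* u) Bs≡1 ⟩
    1ℚ ℚ.+ δ ℚ.* 1ℚ              ≡⟨ cong (1ℚ ℚ.+_) (ℚ.*-identityʳ δ) ⟩
    1ℚ ℚ.+ δ                     ≤⟨ 1+δ≤y ⟩
    y                            ≡⟨ ℚ.*-identityʳ y ⟨
    y ℚ.* 1ℚ                     ∎

⁻¹-<1 : ∀ {x} → 1ℝ < x → (0<x : 0ℝ < x) → x ⁻¹⟨ 0<x ⟩ < 1ℝ
⁻¹-<1 {x} (δ , 0<δ , M , 1+δ≤x) _ =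
  let
    B , 0<B , bnd = bounded (cauchy x)
    N , h = both (M , 1+δ≤x) bnd
  in δ ℚ.* recip B , 0<* 0<δ (recip-pos 0<B) , N , λ n N≤n →
  let 1+δ≤x , ∣x∣≤B = h n N≤n in
  recip-<1 0<δ 1+δ≤x (ℚ.≤-trans (p≤∣p∣ (seq x n)) ∣x∣≤B)

ℝ-rawRing : RawRing 0ℓ 0ℓ
ℝ-rawRing = record
  { Carrier = ℝ
  ; _≈_     = _≈_
  ; _+_     = _+_
  ; _*_     = _*_
  ; -_      = -_
  ; 0#      = 0ℝ
  ; 1#      = 1ℝ
  }

open RawSemiringDefs (RawRing.rawSemiring ℝ-rawRing) public using (sum; _^_)

-- ∑ f is f 0 + f 1 + f 2 + … = s.
HasSum : (ℕ → ℝ) → ℝ → Set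
HasSum f s = ∀ ε → 0ℝ < ε → Eventually λ N →
  let partial = sum {N} (λ k → f (toℕ k)) in
  s - ε < partial × partial < s + ε

Matrix : ℕ → Set
Matrix n = Fin n → Fin n → ℝ

infix  4 _≈ᴹ_
infixl 6 _+ᴹ_ _-ᴹ_
infixl 7 _*ᴹ_
infixr 8 _·ᴹ_

_≈ᴹ_ : ∀ {n} → Matrix n → Matrix n → Set
A ≈ᴹ B = ∀ i j → A i j ≈ B i j

𝕀 : ∀ {n} → Matrix n
𝕀 i j = if does (i Fin.≟ j) then 1ℝ else 0ℝ

_+ᴹ_ _-ᴹ_ _*ᴹ_ : ∀ {n} → Matrix n → Matrix n → Matrix n
(A +ᴹ B) i j = A i j + B i j
(A -ᴹ B) i j = A i j - B i j
(A *ᴹ B) i j = sum λ k → A i k * B k j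

_·ᴹ_ : ∀ {n} → ℝ → Matrix n → Matrix n
(c ·ᴹ A) i j = c * A i j

_IsInverseOf_ : ∀ {n} → Matrix n → Matrix n → Set
B IsInverseOf A = A *ᴹ B ≈ᴹ 𝕀 × B *ᴹ A ≈ᴹ 𝕀

record WeightedDigraph (n : ℕ) : Set₁ where
  field
    Arc        : Fin n → Fin n → Set
    Arc?       : ∀ i j → Dec (Arc i j)
    loopless   : ∀ i → ¬ Arc i i
    ε          : Fin n → Fin n → ℝ
    arc⇒ε>0    : ∀ {i j} → Arc i j → 0ℝ < ε i j
    no-arc⇒ε≈0 : ∀ {i j} → ¬ Arc i j → ε i j ≈ 0ℝ

-- Note the transposition: ℓᵢⱼ = - εⱼᵢ for j ≠ i, and ℓᵢᵢ = - ∑_{k ≠ i} ℓᵢₖ.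
kirchhoff : ∀ {n} → WeightedDigraph n → Matrix n
kirchhoff Γ i j =
  if does (j Fin.≟ i)
  then - sum (λ k → if does (k Fin.≟ i) then 0ℝ else - ε k i)
  else - ε j i
  where open WeightedDigraph Γ

IsNormalizedForestMatrix : ∀ {n} → WeightedDigraph n → ℝ → Matrix n → Set
IsNormalizedForestMatrix Γ τ Q = Q IsInverseOf (𝕀 +ᴹ τ ·ᴹ kirchhoff Γ)

record MarkovChain (n : ℕ) : Set where
  field
    P       : Matrix n
    P≥0     : ∀ i j → 0ℝ ≤ P i j
    row-sum : ∀ i → sum (P i) ≈ 1ℝ

Related : ∀ {n} → WeightedDigraph n → ℝ → MarkovChain n → Set
Related Γ α C = MarkovChain.P C ≈ᴹ 𝕀 -ᴹ α ·ᴹ kirchhoff Γ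

record SuccessProbability : Set where
  field
    q   : ℝ
    0<q : 0ℝ < q
    q<1 : q < 1ℝ

module GeometricObservation {n} (C : MarkovChain n) (S : SuccessProbability) where
  open MarkovChain C
  open SuccessProbability S

  -- The outcome (k , x₀ ∷ … ∷ xₖ) records that the first success occurs at
  -- time T = k and that the chain visits the states x₀, …, xₖ up to then.
  Outcome : Set
  Outcome = Σ ℕ λ k → Vec (Fin n) (suc k)

  trialsWeight : ℕ → ℝ
  trialsWeight k = q * (1ℝ - q) ^ k

  pathWeight : ∀ {k} → Vec (Fin n) (suc k) → ℝ
  pathWeight (x ∷ [])     = 1ℝ
  pathWeight (x ∷ y ∷ xs) = P x y * pathWeight (y ∷ xs)

  -- Probability of a single outcome when X₀ = i; trials and chain are
  -- independent.
  weight : Fin n → Outcome → ℝ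
  weight i (k , xs) = trialsWeight k * (𝕀 i (head xs) * pathWeight xs)

  sumVec : ∀ k → (Vec (Fin n) k → ℝ) → ℝ
  sumVec zero    f = f []
  sumVec (suc k) f = sum λ x → sumVec k λ xs → f (x ∷ xs)

  -- Prᵢ(E) = p, the sum of the weights of the outcomes in E.
  HasProbability : Fin n → {E : Pred Outcome 0ℓ} → Decidable E → ℝ → Set
  HasProbability i E? = HasSum λ k → sumVec (suc k) λ xs →
    if does (E? (k , xs)) then weight i (k , xs) else 0ℝ

  -- X_T = j, where T = k
  ObservedAt : Fin n → Pred Outcome 0ℓ
  ObservedAt j (k , xs) = last xs ≡ j

  observedAt? : ∀ j → Decidable (ObservedAt j)
  observedAt? j (k , xs) = last xs Fin.≟ j

  IsTransitionMatrix : Matrix n → Set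
  IsTransitionMatrix P̃ = ∀ i j → HasProbability i (observedAt? j) (P̃ i j)

successProbability : ∀ τ → 0ℝ < τ → ∀ α → 0ℝ < α → SuccessProbability
successProbability τ 0<τ α 0<α = record
  { q   = y ⁻¹⟨ 0<y ⟩
  ; 0<q = ⁻¹-pos {y} 0<y
  ; q<1 = ⁻¹-<1 {y} 1<y 0<y
  }
  where
  y : ℝ
  y = τ / α ⟨ 0<α ⟩ + 1ℝ
  1<y : 1ℝ < y
  1<y = <+1 {τ / α ⟨ 0<α ⟩} (*-pos {τ} {α ⁻¹⟨ 0<α ⟩} 0<τ (⁻¹-pos {α} 0<α))
  0<y : 0ℝ < y
  0<y = 1<⇒0< {y} 1<y

{-# OPTIONS --safe #-}
-- Since (1 + τ/α) q = 1, the matrix I + τL equals (1/q)(I - (1 - q)P), so its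
-- inverse is the Neumann series ∑ₖ q (1 - q)ᵏ Pᵏ; and q (1 - q)ᵏ (Pᵏ)ᵢⱼ is the
-- probability that the first success occurs at time k with the chain in state
-- j. The powers Pᵏ have entries in [0 , 1], so the partial sums Sₘ increase
-- while Sₘ + (1 - q)ᵐ decreases; these nested intervals give convergence.
module Submission where

open import Algebra.Bundles using (CommutativeRing; Ring)
import Algebra.Properties.CommutativeSemigroup as CommutativeSemigroupProperties
import Algebra.Properties.Monoid.Mult as Mult
import Algebra.Properties.Ring as RingProperties
import Algebra.Properties.Semiring.Sum as SemiringSum
open import Algebra.Structures
  using (IsMagma; IsSemigroup; IsMonoid; IsGroup; IsAbelianGroup; IsRing)
open import Data.Bool.Base using (true; false; if_then_else_)
open import Data.Fin.Base using (Fin; zero; suc; toℕ; inject₁; fromℕ)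
import Data.Fin.Properties as Fin
import Data.Integer.Base as ℤ
import Data.Integer.Properties as ℤ
open import Data.Nat.Base as ℕ using (ℕ; zero; suc)
import Data.Nat.Properties as ℕ
open import Data.Product.Base using (∃-syntax; _×_; _,_; proj₁; proj₂)
open import Data.Rational.Base as ℚ using (ℚ; 0ℚ; 1ℚ; ½; ∣_∣)
import Data.Rational.Properties as ℚ
open import Data.Rational.Solver using (module +-*-Solver)
import Data.Rational.Unnormalised.Base as ℚᵘ
import Data.Rational.Unnormalised.Properties as ℚᵘ
open import Data.Sum.Base using (_⊎_; inj₁; inj₂)
open import Data.Vec.Base using (Vec; []; _∷_; head; last)
open import Level using (0ℓ)
open import Relation.Binary.Bundles using (Preorder)
open import Relation.Binary.Core using (Rel)
open import Relation.Binary.PropositionalEquality using (_≡_; cong; cong₂)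
import Relation.Binary.Reasoning.Preorder as PreorderReasoning
import Relation.Binary.Reasoning.Setoid as SetoidReasoning
open import Relation.Binary.Structures using (IsEquivalence; IsPreorder)
open import Relation.Nullary using (does)
open import Relation.Unary using (Pred)

-- The matrix `Q` is not given in advance: it is built as a limit, and the invertibility of `I + τL`
-- comes out as a by-product. Constructively, boundedness and monotonicity alone do not yield a
-- limit; the shrinking gap between the two monotone sequences supplies the missing rate of
-- convergence. The estimate is made entry by entry, so no matrix norm is involved. Matrices do not
-- commute, so the products `A Q` and `Q A` need separate arguments: the partial sums satisfy one
-- recursion with the factor `(1 - q) P` on the left and one with it on the right. In the limit
-- these become two fixed-point equations for `Q`, and each gives one of the two products by ring
-- algebra alone.

-- Q = J + M Q is the Neumann series of J (1 - M)⁻¹, and A = Y - T = Y (1 - M).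
module _ (R : Ring 0ℓ 0ℓ) where
  open Ring R hiding (zero)
  open RingProperties R
  open SetoidReasoning setoid

  neumann-inverse : ∀ {A T Y J M Q} → A + T ≈ Y → Y * J ≈ 1# → J * Y ≈ 1# →
                    Y * M ≈ T → M * Y ≈ T → Q ≈ J + M * Q → Q ≈ J + Q * M →
                    A * Q ≈ 1# × Q * A ≈ 1#
  neumann-inverse {A} {T} {Y} {J} {M} {Q} A+T≈Y YJ≈1 JY≈1 YM≈T MY≈T Q≈J+MQ Q≈J+QM =
    -- Adding `T * Q` turns `A * Q` into `Y * Q`; then `Y` cancels `J` and turns `M` into `T`.
    +-cancelʳ (T * Q) (A * Q) 1# (begin
      A * Q + T * Q        ≈⟨ distribʳ Q A T ⟨
      (A + T) * Q          ≈⟨ *-congʳ A+T≈Y ⟩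
      Y * Q                ≈⟨ *-congˡ Q≈J+MQ ⟩
      Y * (J + M * Q)      ≈⟨ distribˡ Y J (M * Q) ⟩
      Y * J + Y * (M * Q)  ≈⟨ +-cong YJ≈1 (trans (sym (*-assoc Y M Q)) (*-congʳ YM≈T)) ⟩
      1# + T * Q           ∎)
    , +-cancelʳ (Q * T) (Q * A) 1# (begin
      Q * A + Q * T        ≈⟨ distribˡ Q A T ⟨
      Q * (A + T)          ≈⟨ *-congˡ A+T≈Y ⟩
      Q * Y                ≈⟨ *-congʳ Q≈J+QM ⟩
      (J + Q * M) * Y      ≈⟨ distribʳ Y J (Q * M) ⟩
      J * Y + Q * M * Y    ≈⟨ +-cong JY≈1 (trans (*-assoc Q M Y) (*-congˡ MY≈T)) ⟩
      1# + Q * T           ∎)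

  module NeumannSums {J M : Carrier} (JM≈MJ : J * M ≈ M * J) (S : ℕ → Carrier)
    (S₀≈0 : S zero ≈ 0#) (S₁₊ₙ≈J+MSₙ : ∀ n → S (suc n) ≈ J + M * S n) where

    -- By induction from the left recursion, since `J` commutes with `M`. This form is what makes
    -- the limit a left inverse of `A`.
    S₁₊ₙ≈J+SₙM : ∀ n → S (suc n) ≈ J + S n * M
    S₁₊ₙ≈J+SₙM zero = begin
      S (suc zero)    ≈⟨ S₁₊ₙ≈J+MSₙ zero ⟩
      J + M * S zero  ≈⟨ +-congˡ (trans (*-congˡ S₀≈0) (zeroʳ M)) ⟩
      J + 0#          ≈⟨ +-congˡ (trans (*-congʳ S₀≈0) (zeroˡ M)) ⟨
      J + S zero * M  ∎
    S₁₊ₙ≈J+SₙM (suc n) = begin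
      S (suc (suc n))            ≈⟨ S₁₊ₙ≈J+MSₙ (suc n) ⟩
      J + M * S (suc n)          ≈⟨ +-congˡ (*-congˡ (S₁₊ₙ≈J+SₙM n)) ⟩
      J + M * (J + S n * M)      ≈⟨ +-congˡ (distribˡ M J (S n * M)) ⟩
      J + (M * J + M * (S n * M)) ≈⟨ +-congˡ (+-cong JM≈MJ (*-assoc M (S n) M)) ⟨
      J + (J * M + M * S n * M)  ≈⟨ +-congˡ (distribʳ M J (M * S n)) ⟨
      J + (J + M * S n) * M      ≈⟨ +-congˡ (*-congʳ (S₁₊ₙ≈J+MSₙ n)) ⟨
      J + S (suc n) * M          ∎

    -- a n plays the role of Mⁿ J.
    S₁₊ₙ≈Sₙ+aₙ : (a : ℕ → Carrier) → a zero ≈ J → (∀ n → a (suc n) ≈ M * a n) →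
                  ∀ n → S (suc n) ≈ S n + a n
    S₁₊ₙ≈Sₙ+aₙ a a₀≈J a₁₊ₙ≈Maₙ zero = begin
      S (suc zero)     ≈⟨ S₁₊ₙ≈J+MSₙ zero ⟩
      J + M * S zero   ≈⟨ +-congˡ (trans (*-congˡ S₀≈0) (zeroʳ M)) ⟩
      J + 0#           ≈⟨ +-comm J 0# ⟩
      0# + J           ≈⟨ +-cong S₀≈0 a₀≈J ⟨
      S zero + a zero  ∎
    S₁₊ₙ≈Sₙ+aₙ a a₀≈J a₁₊ₙ≈Maₙ (suc n) = begin
      S (suc (suc n))            ≈⟨ S₁₊ₙ≈J+MSₙ (suc n) ⟩
      J + M * S (suc n)          ≈⟨ +-congˡ (*-congˡ (S₁₊ₙ≈Sₙ+aₙ a a₀≈J a₁₊ₙ≈Maₙ n)) ⟩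
      J + M * (S n + a n)        ≈⟨ +-congˡ (distribˡ M (S n) (a n)) ⟩
      J + (M * S n + M * a n)    ≈⟨ +-assoc J (M * S n) (M * a n) ⟨
      J + M * S n + M * a n      ≈⟨ +-cong (S₁₊ₙ≈J+MSₙ n) (a₁₊ₙ≈Maₙ n) ⟨
      S (suc n) + a (suc n)      ∎

-- The algebra is done abstractly because checking convertibility of sums and
-- products of concrete Cauchy reals unfolds their moduli, which is infeasible.
record CompleteOrderedRing : Set₁ where
  field
    commutativeRing : CommutativeRing 0ℓ 0ℓ
  open CommutativeRing commutativeRing public hiding (zero)
  infix 4 _≲_ _⟶_
  field
    _≲_              : Rel Carrier 0ℓ
    ≲-isPreorder     : IsPreorder _≈_ _≲_
    0≲1              : 0# ≲ 1#
    +-mono-≲         : ∀ {x y u v} → x ≲ y → u ≲ v → x + u ≲ y + v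
    *-monoˡ-≲        : ∀ {c x y} → 0# ≲ c → x ≲ y → c * x ≲ c * y
    _⟶_              : (ℕ → Carrier) → Carrier → Set
    ⟶-unique         : ∀ {f x y} → f ⟶ x → f ⟶ y → x ≈ y
    ⟶-cong           : ∀ {f g x} → (∀ n → f n ≈ g n) → f ⟶ x → g ⟶ x
    ⟶-tail           : ∀ {f x} → f ⟶ x → (λ n → f (suc n)) ⟶ x
    ⟶-const          : ∀ {x} → (λ _ → x) ⟶ x
    ⟶-+              : ∀ {f g x y} → f ⟶ x → g ⟶ y → (λ n → f n + g n) ⟶ x + y
    ⟶-*ˡ             : ∀ {f x} c → f ⟶ x → (λ n → c * f n) ⟶ c * x
    ⟶-*ʳ             : ∀ {f x} c → f ⟶ x → (λ n → f n * c) ⟶ x * c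
    nested-intervals : ∀ {f e} → (∀ n → f n ≲ f (suc n)) →
                       (∀ n → f (suc n) + e (suc n) ≲ f n + e n) →
                       (∀ n → 0# ≲ e n) → e ⟶ 0# → ∃[ x ] f ⟶ x

  ≲-preorder : Preorder 0ℓ 0ℓ 0ℓ
  ≲-preorder = record { isPreorder = ≲-isPreorder }

-- The ring of square matrices.

module Matrices (F : CompleteOrderedRing) (n : ℕ) where
  open CompleteOrderedRing F
  open SemiringSum semiring
  open IsPreorder ≲-isPreorder using () renaming (refl to ≲-refl)

  Mat : Set
  Mat = Fin n → Fin n → Carrier

  -- A record, so that A and B can be inferred from A ≈ₘ B.
  infix 4 _≈ₘ_
  record _≈ₘ_ (A B : Mat) : Set where
    constructor entrywise
    field entry : ∀ i j → A i j ≈ B i j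
  open _≈ₘ_ public

  infixl 6 _⊕_
  infixl 7 _⊗_
  infixr 8 _•_

  _⊕_ _⊗_ : Mat → Mat → Mat
  (A ⊕ B) i j = A i j + B i j
  (A ⊗ B) i j = ∑[ k < n ] (A i k * B k j)

  _•_ : Carrier → Mat → Mat
  (c • A) i j = c * A i j

  𝟘 : Mat
  𝟘 i j = 0#

  -- The size is a free `m` because `sum-𝟙ˡ` and `sum-𝟙ʳ` recurse on it.
  𝟙 : ∀ {m} → Fin m → Fin m → Carrier
  𝟙 i j = if does (i Fin.≟ j) then 1# else 0#

  power : Mat → ℕ → Mat
  power P zero    = 𝟙
  power P (suc k) = P ⊗ power P k

  open SetoidReasoning setoid

  sum-zero : ∀ m (f : Fin m → Carrier) → (∀ k → f k ≈ 0#) → sum f ≈ 0#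
  sum-zero m f f≈0 = trans (sum-cong-≋ f≈0) (sum-replicate-zero m)

  -- The test `suc i Fin.≟ suc k` has the same `does` as `i Fin.≟ k` by computation, so deleting the
  -- first row and column of `𝟙` leaves a smaller `𝟙`.
  sum-𝟙ˡ : ∀ {m} (i : Fin m) (v : Fin m → Carrier) → ∑[ k < m ] (𝟙 i k * v k) ≈ v i
  sum-𝟙ˡ {suc m} zero v = begin
    1# * v zero + ∑[ k < m ] (0# * v (suc k))
      ≈⟨ +-cong (*-identityˡ (v zero)) (sum-zero m _ λ k → zeroˡ (v (suc k))) ⟩
    v zero + 0#  ≈⟨ +-identityʳ (v zero) ⟩
    v zero       ∎
  sum-𝟙ˡ {suc m} (suc i) v = begin
    0# * v zero + ∑[ k < m ] (𝟙 i k * v (suc k))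
      ≈⟨ +-cong (zeroˡ (v zero)) (sum-𝟙ˡ i λ k → v (suc k)) ⟩
    0# + v (suc i)  ≈⟨ +-identityˡ (v (suc i)) ⟩
    v (suc i)       ∎

  sum-𝟙ʳ : ∀ {m} (j : Fin m) (v : Fin m → Carrier) → ∑[ k < m ] (v k * 𝟙 k j) ≈ v j
  sum-𝟙ʳ {suc m} zero v = begin
    v zero * 1# + ∑[ k < m ] (v (suc k) * 0#)
      ≈⟨ +-cong (*-identityʳ (v zero)) (sum-zero m _ λ k → zeroʳ (v (suc k))) ⟩
    v zero + 0#  ≈⟨ +-identityʳ (v zero) ⟩
    v zero       ∎
  sum-𝟙ʳ {suc m} (suc j) v = begin
    v zero * 0# + ∑[ k < m ] (v (suc k) * 𝟙 k j)
      ≈⟨ +-cong (zeroʳ (v zero)) (sum-𝟙ʳ j λ k → v (suc k)) ⟩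
    0# + v (suc j)  ≈⟨ +-identityˡ (v (suc j)) ⟩
    v (suc j)       ∎

  ⊗-assoc : ∀ A B C → (A ⊗ B) ⊗ C ≈ₘ A ⊗ (B ⊗ C)
  ⊗-assoc A B C = entrywise λ i j → begin
    ∑[ k < n ] ((∑[ l < n ] (A i l * B l k)) * C k j)
      ≈⟨ sum-cong-≋ (λ k → *-distribʳ-sum (C k j) (λ l → A i l * B l k)) ⟩
    ∑[ k < n ] ∑[ l < n ] (A i l * B l k * C k j)
      ≈⟨ ∑-comm (λ k l → A i l * B l k * C k j) ⟩
    ∑[ l < n ] ∑[ k < n ] (A i l * B l k * C k j)
      ≈⟨ sum-cong-≋ (λ l → trans (sum-cong-≋ λ k → *-assoc (A i l) (B l k) (C k j))
           (sym (*-distribˡ-sum (A i l) (λ k → B l k * C k j)))) ⟩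
    ∑[ l < n ] (A i l * ∑[ k < n ] (B l k * C k j)) ∎

  ⊗-distribˡ-⊕ : ∀ A B C → A ⊗ (B ⊕ C) ≈ₘ A ⊗ B ⊕ A ⊗ C
  ⊗-distribˡ-⊕ A B C = entrywise λ i j →
    trans (sum-cong-≋ λ k → distribˡ (A i k) (B k j) (C k j))
      (∑-distrib-+ (λ k → A i k * B k j) (λ k → A i k * C k j))

  ⊗-distribʳ-⊕ : ∀ A B C → (B ⊕ C) ⊗ A ≈ₘ B ⊗ A ⊕ C ⊗ A
  ⊗-distribʳ-⊕ A B C = entrywise λ i j →
    trans (sum-cong-≋ λ k → distribʳ (A k j) (B i k) (C i k))
      (∑-distrib-+ (λ k → B i k * A k j) (λ k → C i k * A k j))

  matrixRing : Ring 0ℓ 0ℓ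
  matrixRing = record
    { Carrier = Mat ; _≈_ = _≈ₘ_ ; _+_ = _⊕_ ; _*_ = _⊗_ ; -_ = λ A i j → - A i j ; 0# = 𝟘 ; 1# = 𝟙
    ; isRing = record
      { +-isAbelianGroup = record
        { isGroup = record
          { isMonoid = record
            { isSemigroup = record
              { isMagma = record
                { isEquivalence = record
                  { refl  = entrywise λ i j → refl
                  ; sym   = λ (entrywise h) → entrywise λ i j → sym (h i j)
                  ; trans = λ (entrywise h) (entrywise k) → entrywise λ i j → trans (h i j) (k i j)
                  }
                ; ∙-cong = λ (entrywise h) (entrywise k) → entrywise λ i j → +-cong (h i j) (k i j)
                }
              ; assoc = λ A B C → entrywise λ i j → +-assoc (A i j) (B i j) (C i j)
              }
            ; identity = (λ A → entrywise λ i j → +-identityˡ (A i j))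
                       , (λ A → entrywise λ i j → +-identityʳ (A i j))
            }
          ; inverse = (λ A → entrywise λ i j → -‿inverseˡ (A i j))
                    , (λ A → entrywise λ i j → -‿inverseʳ (A i j))
          ; ⁻¹-cong = λ (entrywise h) → entrywise λ i j → -‿cong (h i j)
          }
        ; comm = λ A B → entrywise λ i j → +-comm (A i j) (B i j)
        }
      ; *-cong = λ (entrywise h) (entrywise k) → entrywise λ i j →
          sum-cong-≋ λ l → *-cong (h i l) (k l j)
      ; *-assoc = ⊗-assoc
      ; *-identity = (λ A → entrywise λ i j → sum-𝟙ˡ i λ k → A k j)
                   , (λ A → entrywise λ i j → sum-𝟙ʳ j (A i))
      ; distrib = ⊗-distribˡ-⊕ , ⊗-distribʳ-⊕
      }
    }

  -- Scalars enter the matrix ring as multiples of `𝟙`, so that a lemma about rings also covers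
  -- scaling.
  •𝟙-⊗ : ∀ c A → (c • 𝟙) ⊗ A ≈ₘ c • A
  •𝟙-⊗ c A = entrywise λ i j → begin
    ∑[ k < n ] (c * 𝟙 i k * A k j)    ≈⟨ sum-cong-≋ (λ k → *-assoc c (𝟙 i k) (A k j)) ⟩
    ∑[ k < n ] (c * (𝟙 i k * A k j))  ≈⟨ *-distribˡ-sum c (λ k → 𝟙 i k * A k j) ⟨
    c * ∑[ k < n ] (𝟙 i k * A k j)    ≈⟨ *-congˡ (sum-𝟙ˡ i λ k → A k j) ⟩
    c * A i j                         ∎

  ⊗-•𝟙 : ∀ c A → A ⊗ (c • 𝟙) ≈ₘ c • A
  ⊗-•𝟙 c A = entrywise λ i j → begin
    ∑[ k < n ] (A i k * (c * 𝟙 k j))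
      ≈⟨ sum-cong-≋ (λ k → trans (sym (*-assoc (A i k) c (𝟙 k j))) (*-congʳ (*-comm (A i k) c))) ⟩
    ∑[ k < n ] (c * A i k * 𝟙 k j)    ≈⟨ sum-𝟙ʳ j (λ k → c * A i k) ⟩
    c * A i j                         ∎

  •-•-⊗ : ∀ c d A B → (c • A) ⊗ (d • B) ≈ₘ (c * d) • (A ⊗ B)
  •-•-⊗ c d A B = entrywise λ i j → begin
    ∑[ k < n ] (c * A i k * (d * B k j))    ≈⟨ sum-cong-≋ (λ k → *-interchange c (A i k) d (B k j)) ⟩
    ∑[ k < n ] (c * d * (A i k * B k j))    ≈⟨ *-distribˡ-sum (c * d) (λ k → A i k * B k j) ⟨
    c * d * ∑[ k < n ] (A i k * B k j)      ∎
    where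
    open CommutativeSemigroupProperties *-commutativeSemigroup
      using () renaming (interchange to *-interchange)

  -- Path weights and powers of the transition matrix.

  module Paths (P : Mat) where

    -- Copies, over the abstract ring, of the definitions in `GeometricObservation`;
    -- `PathProbabilities` matches them with the originals.
    pathWeight : ∀ {k} → Vec (Fin n) (suc k) → Carrier
    pathWeight (x ∷ [])     = 1#
    pathWeight (x ∷ y ∷ xs) = P x y * pathWeight (y ∷ xs)

    sumVec : ∀ k → (Vec (Fin n) k → Carrier) → Carrier
    sumVec zero    f = f []
    sumVec (suc k) f = sum λ x → sumVec k λ xs → f (x ∷ xs)

    sumVec-cong : ∀ k {f g : Vec (Fin n) k → Carrier} → (∀ xs → f xs ≈ g xs) → sumVec k f ≈ sumVec k g
    sumVec-cong zero    f≈g = f≈g []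
    sumVec-cong (suc k) f≈g = sum-cong-≋ λ x → sumVec-cong k λ xs → f≈g (x ∷ xs)

    -- The scalar `c` is an accumulator for the factors already collected before the head of `xs`.
    endingAt : Fin n → Carrier → ∀ {k} → Vec (Fin n) (suc k) → Carrier
    endingAt j c xs = if does (last xs Fin.≟ j) then c * pathWeight xs else 0#

    if-congˡ : ∀ b {x y z : Carrier} → x ≈ y → (if b then x else z) ≈ (if b then y else z)
    if-congˡ true  x≈y = x≈y
    if-congˡ false x≈y = refl

    if-*-1 : ∀ b c → (if b then c * 1# else 0#) ≈ c * (if b then 1# else 0#)
    if-*-1 true  c = refl
    if-*-1 false c = sym (zeroʳ c)

    sum-*-assoc : ∀ c (u v : Fin n → Carrier) → ∑[ l < n ] (c * u l * v l) ≈ c * ∑[ l < n ] (u l * v l)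
    sum-*-assoc c u v = trans (sum-cong-≋ λ l → *-assoc c (u l) (v l))
      (sym (*-distribˡ-sum c λ l → u l * v l))

    -- Induction with `c` general: the first transition `P x y` moves into the accumulator, so
    -- multiplication never has to be pulled out of the conditional except for paths of length 0.
    path-sum : ∀ k j c x → sumVec k (λ xs → endingAt j c (x ∷ xs)) ≈ c * power P k x j
    path-sum zero    j c x = if-*-1 (does (x Fin.≟ j)) c
    path-sum (suc k) j c x = begin
      ∑[ y < n ] sumVec k (λ xs → endingAt j c (x ∷ y ∷ xs))
        ≈⟨ sum-cong-≋ (λ y → sumVec-cong k λ xs → if-congˡ (does (last (y ∷ xs) Fin.≟ j))
             (sym (*-assoc c (P x y) (pathWeight (y ∷ xs))))) ⟩
      ∑[ y < n ] sumVec k (λ xs → endingAt j (c * P x y) (y ∷ xs))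
        ≈⟨ sum-cong-≋ (λ y → path-sum k j (c * P x y) y) ⟩
      ∑[ y < n ] (c * P x y * power P k y j)
        ≈⟨ sum-*-assoc c (P x) (λ y → power P k y j) ⟩
      c * power P (suc k) x j ∎

    outcomeWeight : Carrier → Fin n → ∀ {k} → Vec (Fin n) (suc k) → Carrier
    outcomeWeight c i xs = c * (𝟙 i (head xs) * pathWeight xs)

    observed : Carrier → Fin n → Fin n → ∀ {k} → Vec (Fin n) (suc k) → Carrier
    observed c i j xs = if does (last xs Fin.≟ j) then outcomeWeight c i xs else 0#

    -- The indicator of the initial state is absorbed into the accumulator just like a transition
    -- probability.
    observed-sum : ∀ c i j k → sumVec (suc k) (observed c i j) ≈ c * power P k i j
    observed-sum c i j k = begin
      ∑[ x < n ] sumVec k (λ xs → observed c i j (x ∷ xs))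
        ≈⟨ sum-cong-≋ (λ x → sumVec-cong k λ xs → if-congˡ (does (last (x ∷ xs) Fin.≟ j))
             (sym (*-assoc c (𝟙 i x) (pathWeight (x ∷ xs))))) ⟩
      ∑[ x < n ] sumVec k (λ xs → endingAt j (c * 𝟙 i x) (x ∷ xs))
        ≈⟨ sum-cong-≋ (λ x → path-sum k j (c * 𝟙 i x) x) ⟩
      ∑[ x < n ] (c * 𝟙 i x * power P k x j)
        ≈⟨ sum-*-assoc c (𝟙 i) (λ x → power P k x j) ⟩
      c * ∑[ x < n ] (𝟙 i x * power P k x j)
        ≈⟨ *-congˡ (sum-𝟙ˡ i λ x → power P k x j) ⟩
      c * power P k i j ∎

  -- Convergence of the Neumann series.

  sum-mono : ∀ {m} {u v : Fin m → Carrier} → (∀ k → u k ≲ v k) → sum u ≲ sum v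
  sum-mono {zero}  u≲v = ≲-refl
  sum-mono {suc m} u≲v = +-mono-≲ (u≲v zero) (sum-mono λ k → u≲v (suc k))

  ⟶-sum : ∀ {m} {f : ℕ → Fin m → Carrier} {x} → 
          (∀ i → (λ k → f k i) ⟶ x i) → (λ k → sum (f k)) ⟶ sum x
  ⟶-sum {zero}  f⟶x = ⟶-const
  ⟶-sum {suc m} f⟶x = ⟶-+ (f⟶x zero) (⟶-sum λ i → f⟶x (suc i))

  -- Here `r`, `w k` and `c k` stand for `1 - q`, its `k`th power and the probability that `T`
  -- equals `k`. They are known only through equations, never as concrete terms.
  module NeumannSeries {P : Mat} (0≲P : ∀ i j → 0# ≲ P i j) (∑P≈1 : ∀ i → sum (P i) ≈ 1#)
    {q r : Carrier} (0≲q : 0# ≲ q) (q+r≈1 : q + r ≈ 1#)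
    {w : ℕ → Carrier} (w₀≈1 : w zero ≈ 1#) (w₁₊ₙ≈r*wₙ : ∀ k → w (suc k) ≈ r * w k)
    (0≲w : ∀ k → 0# ≲ w k) (w⟶0 : w ⟶ 0#)
    {c : ℕ → Carrier} (c≈q*w : ∀ k → c k ≈ q * w k) where

    module ≲ = PreorderReasoning ≲-preorder
    module M = Ring matrixRing

    *-nonNeg : ∀ {x y} → 0# ≲ x → 0# ≲ y → 0# ≲ x * y
    *-nonNeg {x} {y} 0≲x 0≲y = ≲.begin
      0#      ≲.≈⟨ zeroʳ x ⟨
      x * 0#  ≲.≲⟨ *-monoˡ-≲ 0≲x 0≲y ⟩
      x * y   ≲.∎

    0≲𝟙 : ∀ (i j : Fin n) → 0# ≲ 𝟙 i j
    0≲𝟙 i j with does (i Fin.≟ j)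
    ... | true  = 0≲1
    ... | false = ≲-refl

    𝟙≲1 : ∀ (i j : Fin n) → 𝟙 i j ≲ 1#
    𝟙≲1 i j with does (i Fin.≟ j)
    ... | true  = ≲-refl
    ... | false = 0≲1

    0≲power : ∀ k i j → 0# ≲ power P k i j
    0≲power zero    i j = 0≲𝟙 i j
    0≲power (suc k) i j = ≲.begin
      0#                                  ≲.≈⟨ sum-zero n _ (λ _ → refl) ⟨
      ∑[ l < n ] 0#                       ≲.≲⟨ sum-mono (λ l → *-nonNeg (0≲P i l) (0≲power k l j)) ⟩
      ∑[ l < n ] (P i l * power P k l j)    ≲.∎

    -- An entry of the next power is a weighted mean, with weights `P i l`, of entries of the
    -- previous one.
    power≲1 : ∀ k i j → power P k i j ≲ 1#
    power≲1 zero    i j = 𝟙≲1 i j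
    power≲1 (suc k) i j = ≲.begin
      ∑[ l < n ] (P i l * power P k l j)  ≲.≲⟨ sum-mono (λ l → *-monoˡ-≲ (0≲P i l) (power≲1 k l j)) ⟩
      ∑[ l < n ] (P i l * 1#)           ≲.≈⟨ sum-cong-≋ (λ l → *-identityʳ (P i l)) ⟩
      ∑[ l < n ] P i l                  ≲.≈⟨ ∑P≈1 i ⟩
      1#                                ≲.∎

    J N : Mat
    J = q • 𝟙
    N = r • P

    term : ℕ → Mat
    term k = c k • power P k

    -- Partial sums in Horner form: the recursion, unlike a sum of terms, turns directly into a
    -- fixed-point equation in the limit.
    S : ℕ → Mat
    S zero    = 𝟘
    S (suc k) = J ⊕ N ⊗ S k

    term₀≈J : term zero ≈ₘ J
    term₀≈J = entrywise λ i j → *-congʳ (trans (c≈q*w zero) (trans (*-congˡ w₀≈1) (*-identityʳ q)))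

    term₁₊ₖ≈N⊗termₖ : ∀ k → term (suc k) ≈ₘ N ⊗ term k
    term₁₊ₖ≈N⊗termₖ k = M.sym (M.trans (•-•-⊗ r (c k) P (power P k))
      (entrywise λ i j → *-congʳ (begin
        r * c k        ≈⟨ *-congˡ (c≈q*w k) ⟩
        r * (q * w k)  ≈⟨ *-assoc r q (w k) ⟨
        r * q * w k    ≈⟨ *-congʳ (*-comm r q) ⟩
        q * r * w k    ≈⟨ *-assoc q r (w k) ⟩
        q * (r * w k)  ≈⟨ *-congˡ (w₁₊ₙ≈r*wₙ k) ⟨
        q * w (suc k)  ≈⟨ c≈q*w (suc k) ⟨
        c (suc k)      ∎)))

    open NeumannSums matrixRing {J} {N} (M.trans (•𝟙-⊗ q N) (M.sym (⊗-•𝟙 q N))) S M.refl (λ _ → M.refl)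

    S-step : ∀ k i j → S (suc k) i j ≈ S k i j + term k i j
    S-step k = entry (S₁₊ₙ≈Sₙ+aₙ term term₀≈J term₁₊ₖ≈N⊗termₖ k)

    partial-sum : ∀ i j m → ∑[ k < m ] term (toℕ k) i j ≈ S m i j
    partial-sum i j zero    = refl
    partial-sum i j (suc m) = begin
      ∑[ k < suc m ] term (toℕ k) i j
        -- `sum` unfolds at its first index, whereas `S-step` adds the last term.
        ≈⟨ sum-init-last {m} (λ k → term (toℕ k) i j) ⟩
      ∑[ k < m ] term (toℕ (inject₁ k)) i j + term (toℕ (fromℕ m)) i j
        ≡⟨ cong₂ _+_ (sum-cong-≗ {m} λ k → cong (λ l → term l i j) (Fin.toℕ-inject₁ k))
             (cong (λ l → term l i j) (Fin.toℕ-fromℕ m)) ⟩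
      ∑[ k < m ] term (toℕ k) i j + term m i j
        ≈⟨ +-congʳ (partial-sum i j m) ⟩
      S m i j + term m i j
        ≈⟨ S-step m i j ⟨
      S (suc m) i j ∎

    0≲c : ∀ k → 0# ≲ c k
    0≲c k = ≲.begin
      0#       ≲.≲⟨ *-nonNeg 0≲q (0≲w k) ⟩
      q * w k  ≲.≈⟨ c≈q*w k ⟨
      c k      ≲.∎

    S-ascending : ∀ i j k → S k i j ≲ S (suc k) i j
    S-ascending i j k = ≲.begin
      S k i j               ≲.≈⟨ +-identityʳ (S k i j) ⟨
      S k i j + 0#          ≲.≲⟨ +-mono-≲ ≲-refl (*-nonNeg (0≲c k) (0≲power k i j)) ⟩
      S k i j + term k i j  ≲.≈⟨ S-step k i j ⟨
      S (suc k) i j         ≲.∎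

    -- The weight `w k` is the total mass of the outcome times from `k` on. The term added at `k` is
    -- at most `q * w k`, and `r * w k` is what remains because `q + r` is 1.
    S+w-descending : ∀ i j k → S (suc k) i j + w (suc k) ≲ S k i j + w k
    S+w-descending i j k = ≲.begin
      S (suc k) i j + w (suc k)            ≲.≈⟨ +-cong (S-step k i j) (w₁₊ₙ≈r*wₙ k) ⟩
      S k i j + term k i j + r * w k       ≲.≲⟨ +-mono-≲ (+-mono-≲ ≲-refl
                                                   (*-monoˡ-≲ (0≲c k) (power≲1 k i j))) ≲-refl ⟩
      S k i j + c k * 1# + r * w k         ≲.≈⟨ +-congʳ (+-congˡ (trans (*-identityʳ (c k)) (c≈q*w k))) ⟩
      S k i j + q * w k + r * w k          ≲.≈⟨ +-assoc (S k i j) (q * w k) (r * w k) ⟩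
      S k i j + (q * w k + r * w k)        ≲.≈⟨ +-congˡ (distribʳ (w k) q r) ⟨
      S k i j + (q + r) * w k              ≲.≈⟨ +-congˡ (trans (*-congʳ q+r≈1) (*-identityˡ (w k))) ⟩
      S k i j + w k                        ≲.∎

    convergence : ∀ i j → ∃[ x ] (λ k → S k i j) ⟶ x
    convergence i j = nested-intervals (S-ascending i j) (S+w-descending i j) 0≲w w⟶0

    Q : Mat
    Q i j = proj₁ (convergence i j)

    S⟶Q : ∀ i j → (λ k → S k i j) ⟶ Q i j
    S⟶Q i j = proj₂ (convergence i j)

    -- Both sides are limits of the shifted sequence `S (suc k)`, and limits are unique.
    Q≈J⊕N⊗Q : Q ≈ₘ J ⊕ N ⊗ Q
    Q≈J⊕N⊗Q = entrywise λ i j → ⟶-unique (⟶-tail (S⟶Q i j))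
      (⟶-+ ⟶-const (⟶-sum λ k → ⟶-*ˡ (N i k) (S⟶Q k j)))

    Q≈J⊕Q⊗N : Q ≈ₘ J ⊕ Q ⊗ N
    Q≈J⊕Q⊗N = entrywise λ i j → ⟶-unique (⟶-tail (S⟶Q i j))
      (⟶-cong (λ k → sym (entry (S₁₊ₙ≈J+SₙM k) i j))
        (⟶-+ ⟶-const (⟶-sum λ k → ⟶-*ʳ (N k j) (S⟶Q i k))))

    -- In the application `A` is `I + τL`, `t` is `τ/α` and `y` is `τ/α + 1`, the reciprocal of `q`.
    module _ {A : Mat} {y t : Carrier} (A⊕tP≈y : A ⊕ t • P ≈ₘ y • 𝟙) (y*q≈1 : y * q ≈ 1#)
      (y*r≈t : y * r ≈ t) where

      Q-inverse : A ⊗ Q ≈ₘ 𝟙 × Q ⊗ A ≈ₘ 𝟙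
      Q-inverse = neumann-inverse matrixRing A⊕tP≈y
        (M.trans (•𝟙-⊗ y J) (scalar y*q≈1))
        (M.trans (⊗-•𝟙 y J) (scalar y*q≈1))
        (M.trans (•𝟙-⊗ y N) (entrywise λ i j → trans (sym (*-assoc y r (P i j))) (*-congʳ y*r≈t)))
        (M.trans (⊗-•𝟙 y N) (entrywise λ i j → trans (sym (*-assoc y r (P i j))) (*-congʳ y*r≈t)))
        Q≈J⊕N⊗Q Q≈J⊕Q⊗N
        where
        scalar : y * q ≈ 1# → y • J ≈ₘ 𝟙
        scalar eq = entrywise λ i j → trans (sym (*-assoc y q (𝟙 i j))) (trans (*-congʳ eq) (*-identityˡ (𝟙 i j)))

    neumann-series : ∀ {A y t} → A ⊕ t • P ≈ₘ y • 𝟙 → y * q ≈ 1# → y * r ≈ t →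
      ∃[ Q ] (∀ i j → (λ m → ∑[ k < m ] (c (toℕ k) * power P (toℕ k) i j)) ⟶ Q i j) ×
             A ⊗ Q ≈ₘ 𝟙 × Q ⊗ A ≈ₘ 𝟙
    neumann-series A⊕tP≈y y*q≈1 y*r≈t =
      Q , (λ i j → ⟶-cong (λ m → sym (partial-sum i j m)) (S⟶Q i j)) , Q-inverse A⊕tP≈y y*q≈1 y*r≈t

open import Defs
open import Relation.Binary.PropositionalEquality using (refl; sym; trans; subst; subst₂)
open +-*-Solver using (solve; _:+_; _:*_; _:-_; :-_; _:=_; con)

-- Rational estimates and the Archimedean property.

eventually-map : ∀ {P Q : Pred ℕ 0ℓ} → (∀ n → P n → Q n) → Eventually P → Eventually Q
eventually-map f (N , h) = N , λ n N≤n → f n (h n N≤n)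

0<½* : ∀ {ε} → 0ℚ ℚ.< ε → 0ℚ ℚ.< ε ℚ.* ½
0<½* 0<ε = 0<* 0<ε 0<½

∣p-p∣<ε : ∀ {ε} p → 0ℚ ℚ.< ε → ∣ p ℚ.- p ∣ ℚ.< ε
∣p-p∣<ε {ε} p = subst (λ d → ∣ d ∣ ℚ.< ε) (sym (ℚ.+-inverseʳ p))

∣p-q∣≡∣q-p∣ : ∀ p q → ∣ p ℚ.- q ∣ ≡ ∣ q ℚ.- p ∣
∣p-q∣≡∣q-p∣ p q = trans (sym (ℚ.∣-p∣≡∣p∣ (p ℚ.- q)))
  (cong ∣_∣ (solve 2 (λ p q → :- (p :- q) := q :- p) refl p q))

∣p-r∣≤∣p-q∣+∣q-r∣ : ∀ p q r → ∣ p ℚ.- r ∣ ℚ.≤ ∣ p ℚ.- q ∣ ℚ.+ ∣ q ℚ.- r ∣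
∣p-r∣≤∣p-q∣+∣q-r∣ p q r = subst (λ d → ∣ d ∣ ℚ.≤ ∣ p ℚ.- q ∣ ℚ.+ ∣ q ℚ.- r ∣)
  (solve 3 (λ p q r → (p :- q) :+ (q :- r) := p :- r) refl p q r)
  (ℚ.∣p+q∣≤∣p∣+∣q∣ (p ℚ.- q) (q ℚ.- r))

p≤q+c⇒p-q≤c : ∀ {p q c} → p ℚ.≤ q ℚ.+ c → p ℚ.- q ℚ.≤ c
p≤q+c⇒p-q≤c {p} {q} {c} p≤q+c = subst (p ℚ.- q ℚ.≤_)
  (solve 2 (λ q c → q :+ c :- q := c) refl q c) (ℚ.+-monoˡ-≤ (ℚ.- q) p≤q+c)

p-q≤c⇒p≤q+c : ∀ {p q c} → p ℚ.- q ℚ.≤ c → p ℚ.≤ q ℚ.+ c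
p-q≤c⇒p≤q+c {p} {q} {c} p-q≤c = subst (ℚ._≤ q ℚ.+ c)
  (solve 2 (λ p q → q :+ (p :- q) := p) refl p q) (ℚ.+-monoʳ-≤ q p-q≤c)

∣p-q∣≤c : ∀ {p q c} → p ℚ.≤ q ℚ.+ c → q ℚ.≤ p ℚ.+ c → ∣ p ℚ.- q ∣ ℚ.≤ c
∣p-q∣≤c {p} {q} {c} p≤q+c q≤p+c with ℚ.∣p∣≡p∨∣p∣≡-p (p ℚ.- q)
... | inj₁ eq = subst (ℚ._≤ c) (sym eq) (p≤q+c⇒p-q≤c p≤q+c)
... | inj₂ eq = subst (ℚ._≤ c)
  (sym (trans eq (solve 2 (λ p q → :- (p :- q) := q :- p) refl p q))) (p≤q+c⇒p-q≤c q≤p+c)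

∣p-q∣≤c⇒p≤q+c : ∀ p q {c} → ∣ p ℚ.- q ∣ ℚ.≤ c → p ℚ.≤ q ℚ.+ c
∣p-q∣≤c⇒p≤q+c p q h = p-q≤c⇒p≤q+c (ℚ.≤-trans (p≤∣p∣ (p ℚ.- q)) h)

-- `n ⨯ 1ℚ` embeds the natural numbers in the rationals. As an iterated sum it satisfies
-- `suc n ⨯ 1ℚ = 1ℚ + n ⨯ 1ℚ` by computation.
open Mult ℚ.+-0-monoid using () renaming (_×_ to _⨯_)

⨯1≃/1 : ∀ n → ℚ.toℚᵘ (n ⨯ 1ℚ) ℚᵘ.≃ ℤ.+ n ℚᵘ./ 1
⨯1≃/1 zero    = ℚᵘ.≃-refl
⨯1≃/1 (suc n) = ℚᵘ.≃-trans (ℚ.toℚᵘ-homo-+ 1ℚ (n ⨯ 1ℚ))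
  (ℚᵘ.≃-trans (ℚᵘ.+-congʳ ℚᵘ.1ℚᵘ (⨯1≃/1 n))
    (ℚᵘ.*≡* (cong (λ i → (ℤ.1ℤ ℤ.+ i) ℤ.* ℤ.1ℤ) (ℤ.*-identityʳ (ℤ.+ n)))))

-- Multiplying by the denominator leaves the numerator, a positive integer.
1≤p*↧p : ∀ {p} → 0ℚ ℚ.< p → 1ℚ ℚ.≤ p ℚ.* (ℚ.↧ₙ p ⨯ 1ℚ)
1≤p*↧p {p@(ℚ.mkℚ (ℤ.+ suc k) d _)} _ = ℚ.toℚᵘ-cancel-≤ (ℚᵘ.≤-trans
  (ℚᵘ.*≤* (ℤ.+≤+ (bound k)))
  (ℚᵘ.≤-reflexive (ℚᵘ.≃-sym (ℚᵘ.≃-trans (ℚ.toℚᵘ-homo-* p (suc d ⨯ 1ℚ))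
    (ℚᵘ.*-congˡ {ℚ.toℚᵘ p} (⨯1≃/1 (suc d)))))))
  where
  open ℕ.≤-Reasoning
  bound : ∀ k → 1 ℕ.* (suc d ℕ.* 1) ℕ.≤ suc k ℕ.* suc d ℕ.* 1
  bound k = begin
    1 ℕ.* (suc d ℕ.* 1)    ≤⟨ ℕ.*-monoˡ-≤ (suc d ℕ.* 1) (ℕ.s≤s (ℕ.z≤n {k})) ⟩
    suc k ℕ.* (suc d ℕ.* 1) ≡⟨ ℕ.*-assoc (suc k) (suc d) 1 ⟨
    suc k ℕ.* suc d ℕ.* 1  ∎
1≤p*↧p {ℚ.mkℚ (ℤ.+ zero) d c}  0<p with () ← ℚ.positive 0<p
1≤p*↧p {ℚ.mkℚ ℤ.-[1+ k ] d c} 0<p with () ← ℚ.positive 0<p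

0≤n⨯1 : ∀ n → 0ℚ ℚ.≤ n ⨯ 1ℚ
0≤n⨯1 zero    = ℚ.≤-refl
0≤n⨯1 (suc n) = ℚ.+-mono-≤ (ℚ.<⇒≤ 0<1) (0≤n⨯1 n)

⨯1-mono : ∀ {m n} → m ℕ.≤ n → m ⨯ 1ℚ ℚ.≤ n ⨯ 1ℚ
⨯1-mono {n = n} ℕ.z≤n = 0≤n⨯1 n
⨯1-mono (ℕ.s≤s m≤n)   = ℚ.+-monoʳ-≤ 1ℚ (⨯1-mono m≤n)

archimedean : ∀ {ε} → 0ℚ ℚ.< ε → Eventually λ n → 1ℚ ℚ.≤ ε ℚ.* (n ⨯ 1ℚ)
archimedean {ε} 0<ε = ℚ.↧ₙ ε , λ n h → ℚ.≤-trans (1≤p*↧p 0<ε)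
  (ℚ.*-monoˡ-≤-nonNeg ε {{ℚ.nonNegative (ℚ.<⇒≤ 0<ε)}} (⨯1-mono h))

-- The reals as a commutative ring.

infix 4 _≃_ _≲_ _≈[_]_

-- The relations of Defs unfold to function types, from which Agda cannot
-- recover the related reals; records make them inferable. Rewrapping a proof p
-- as ≈⇒≃ (p .≃⇒≈) restates it for convertible reals: Agda then compares the
-- rational sequences only, not the unfolded Cauchy moduli. For the same reason
-- many real arguments are given explicitly below.
record _≃_ (x y : ℝ) : Set where
  constructor ≈⇒≃
  field ≃⇒≈ : x ≈ y
open _≃_

record _≲_ (x y : ℝ) : Set where
  constructor ≤⇒≲
  field ≲⇒≤ : x ≤ y

record _≈[_]_ (x : ℝ) (ε : ℚ) (y : ℝ) : Set where
  constructor near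
  field eventually : Eventually λ n → ∣ seq x n ℚ.- seq y n ∣ ℚ.< ε
open _≈[_]_

≃⇒near : ∀ {x y ε} → 0ℚ ℚ.< ε → x ≃ y → x ≈[ ε ] y
≃⇒near 0<ε x≃y = near (≃⇒≈ x≃y _ 0<ε)

near⇒≃ : ∀ {x y} → (∀ ε → 0ℚ ℚ.< ε → x ≈[ ε ] y) → x ≃ y
near⇒≃ h = ≈⇒≃ λ ε 0<ε → eventually (h ε 0<ε)

near-≤ : ∀ {x y ε δ} → ε ℚ.≤ δ → x ≈[ ε ] y → x ≈[ δ ] y
near-≤ ε≤δ (near h) = near (eventually-map (λ _ <ε → ℚ.<-≤-trans <ε ε≤δ) h)

near-halves : ∀ {x y ε} → x ≈[ ε ℚ.* ½ ℚ.+ ε ℚ.* ½ ] y → x ≈[ ε ] y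
near-halves {x} {y} {ε} = subst (x ≈[_] y) (halves ε)

near-sym : ∀ {x y ε} → x ≈[ ε ] y → y ≈[ ε ] x
near-sym {x} {y} {ε} (near h) =
  near (eventually-map (λ n → subst (ℚ._< ε) (∣p-q∣≡∣q-p∣ (seq x n) (seq y n))) h)

near-trans : ∀ {x y z ε δ} → x ≈[ ε ] y → y ≈[ δ ] z → x ≈[ ε ℚ.+ δ ] z
near-trans {x} {y} {z} (near h) (near k) = near (eventually-map (λ n (xy , yz) →
  ℚ.≤-<-trans (∣p-r∣≤∣p-q∣+∣q-r∣ (seq x n) (seq y n) (seq z n)) (ℚ.+-mono-< xy yz)) (both h k))

near-+ : ∀ {x y u v ε δ} → x ≈[ ε ] y → u ≈[ δ ] v → x + u ≈[ ε ℚ.+ δ ] y + v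
near-+ {x} {y} {u} {v} {ε} {δ} (near h) (near k) = near (eventually-map (λ n (xy , uv) →
  ℚ.≤-<-trans (subst (λ d → ∣ d ∣ ℚ.≤ ∣ seq x n ℚ.- seq y n ∣ ℚ.+ ∣ seq u n ℚ.- seq v n ∣)
    (solve 4 (λ a b c d → (a :- b) :+ (c :- d) := (a :+ c) :- (b :+ d)) refl
       (seq x n) (seq y n) (seq u n) (seq v n))
    (ℚ.∣p+q∣≤∣p∣+∣q∣ (seq x n ℚ.- seq y n) (seq u n ℚ.- seq v n)))
  (ℚ.+-mono-< xy uv)) (both h k))

near-neg : ∀ {x y ε} → x ≈[ ε ] y → - x ≈[ ε ] - y
near-neg {x} {y} {ε} (near h) = near (eventually-map (λ n → subst (ℚ._< ε)
  (trans (sym (ℚ.∣-p∣≡∣p∣ (seq x n ℚ.- seq y n)))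
    (cong ∣_∣ (solve 2 (λ a b → :- (a :- b) := (:- a) :- (:- b)) refl (seq x n) (seq y n))))) h)

∣c*x-c*y∣<B*δ : ∀ {B δ} → 0ℚ ℚ.< B → ∀ c x y → ∣ c ∣ ℚ.≤ B → ∣ x ℚ.- y ∣ ℚ.< δ →
                ∣ c ℚ.* x ℚ.- c ℚ.* y ∣ ℚ.< B ℚ.* δ
∣c*x-c*y∣<B*δ {B} {δ} 0<B c x y ∣c∣≤B ∣x-y∣<δ = begin-strict
  ∣ c ℚ.* x ℚ.- c ℚ.* y ∣
    ≡⟨ cong ∣_∣ (solve 3 (λ c x y → c :* x :- c :* y := c :* (x :- y)) refl c x y) ⟩
  ∣ c ℚ.* (x ℚ.- y) ∣      ≡⟨ ℚ.∣p*q∣≡∣p∣*∣q∣ c (x ℚ.- y) ⟩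
  ∣ c ∣ ℚ.* ∣ x ℚ.- y ∣    ≤⟨ ℚ.*-monoʳ-≤-nonNeg ∣ x ℚ.- y ∣ {{ℚ.∣-∣-nonNeg (x ℚ.- y)}} ∣c∣≤B ⟩
  B ℚ.* ∣ x ℚ.- y ∣        <⟨ ℚ.*-monoʳ-<-pos B {{ℚ.positive 0<B}} ∣x-y∣<δ ⟩
  B ℚ.* δ                  ∎
  where open ℚ.≤-Reasoning

-- The tolerance `δ` depends on `c` and `ε` only; in `⟶-*ˡ` one `δ` has to serve all members of a
-- sequence.
near-*ˡ : ∀ c {ε} → 0ℚ ℚ.< ε → ∃[ δ ] 0ℚ ℚ.< δ × (∀ x y → x ≈[ δ ] y → c * x ≈[ ε ] c * y)
near-*ˡ c {ε} 0<ε =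
  let
    B , 0<B , ∣c∣≤B = bounded (cauchy c)
    δ , 0<δ , Bδ≡ε = scale 0<B 0<ε
  in δ , 0<δ , λ x y (near h) → near (eventually-map (λ n (c≤B , xy) →
    subst (∣ seq c n ℚ.* seq x n ℚ.- seq c n ℚ.* seq y n ∣ ℚ.<_) Bδ≡ε
      (∣c*x-c*y∣<B*δ 0<B (seq c n) (seq x n) (seq y n) c≤B xy)) (both ∣c∣≤B h))

-- Lets the ring axioms be inherited from the rationals term by term; only the congruences need
-- estimates.
pointwise : ∀ {x y} → (∀ n → seq x n ≡ seq y n) → x ≃ y
pointwise {x} {y} eq = ≈⇒≃ λ ε 0<ε → 0 , λ n _ →
  subst (λ p → ∣ seq x n ℚ.- p ∣ ℚ.< ε) (eq n) (∣p-p∣<ε (seq x n) 0<ε)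

≃-refl : ∀ {x} → x ≃ x
≃-refl = pointwise λ _ → refl

≃-sym : ∀ {x y} → x ≃ y → y ≃ x
≃-sym x≃y = near⇒≃ λ _ 0<ε → near-sym (≃⇒near 0<ε x≃y)

≃-trans : ∀ {x y z} → x ≃ y → y ≃ z → x ≃ z
≃-trans x≃y y≃z = near⇒≃ λ _ 0<ε →
  near-halves (near-trans (≃⇒near (0<½* 0<ε) x≃y) (≃⇒near (0<½* 0<ε) y≃z))

+-cong : ∀ {x y u v} → x ≃ y → u ≃ v → x + u ≃ y + v
+-cong x≃y u≃v = near⇒≃ λ _ 0<ε →
  near-halves (near-+ (≃⇒near (0<½* 0<ε) x≃y) (≃⇒near (0<½* 0<ε) u≃v))

*-congˡ : ∀ {c x y} → x ≃ y → c * x ≃ c * y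
*-congˡ {c} {x} {y} x≃y = near⇒≃ λ ε 0<ε →
  let _ , 0<δ , close = near-*ˡ c 0<ε in close x y (≃⇒near 0<δ x≃y)

*-comm : ∀ x y → x * y ≃ y * x
*-comm x y = pointwise λ n → ℚ.*-comm (seq x n) (seq y n)

*-cong : ∀ {x y u v} → x ≃ y → u ≃ v → x * u ≃ y * v
*-cong {x} {y} {u} {v} x≃y u≃v = ≃-trans (*-congˡ {x} {u} {v} u≃v)
  (≃-trans (*-comm x v) (≃-trans (*-congˡ {v} {x} {y} x≃y) (*-comm v y)))

+-assoc : ∀ x y z → x + y + z ≃ x + (y + z)
+-assoc x y z = pointwise λ n → ℚ.+-assoc (seq x n) (seq y n) (seq z n)

+-comm : ∀ x y → x + y ≃ y + x
+-comm x y = pointwise λ n → ℚ.+-comm (seq x n) (seq y n)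

+-identityˡ : ∀ x → 0ℝ + x ≃ x
+-identityˡ x = pointwise λ n → ℚ.+-identityˡ (seq x n)

+-identityʳ : ∀ x → x + 0ℝ ≃ x
+-identityʳ x = pointwise λ n → ℚ.+-identityʳ (seq x n)

-‿inverseˡ : ∀ x → - x + x ≃ 0ℝ
-‿inverseˡ x = pointwise λ n → ℚ.+-inverseˡ (seq x n)

-‿inverseʳ : ∀ x → x + - x ≃ 0ℝ
-‿inverseʳ x = pointwise λ n → ℚ.+-inverseʳ (seq x n)

-‿cong : ∀ {x y} → x ≃ y → - x ≃ - y
-‿cong x≃y = near⇒≃ λ _ 0<ε → near-neg (≃⇒near 0<ε x≃y)

*-assoc : ∀ x y z → x * y * z ≃ x * (y * z)
*-assoc x y z = pointwise λ n → ℚ.*-assoc (seq x n) (seq y n) (seq z n)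

*-identityˡ : ∀ x → 1ℝ * x ≃ x
*-identityˡ x = pointwise λ n → ℚ.*-identityˡ (seq x n)

*-identityʳ : ∀ x → x * 1ℝ ≃ x
*-identityʳ x = pointwise λ n → ℚ.*-identityʳ (seq x n)

*-distribˡ-+ : ∀ x y z → x * (y + z) ≃ x * y + x * z
*-distribˡ-+ x y z = pointwise λ n → ℚ.*-distribˡ-+ (seq x n) (seq y n) (seq z n)

*-distribʳ-+ : ∀ x y z → (y + z) * x ≃ y * x + z * x
*-distribʳ-+ x y z = pointwise λ n → ℚ.*-distribʳ-+ (seq x n) (seq y n) (seq z n)

≃-isEquivalence : IsEquivalence _≃_
≃-isEquivalence = record { refl = ≃-refl ; sym = ≃-sym ; trans = ≃-trans }

+-isMagma : IsMagma _≃_ _+_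
+-isMagma = record
  { isEquivalence = ≃-isEquivalence ; ∙-cong = λ {x} {y} {u} {v} → +-cong {x} {y} {u} {v} }

+-isSemigroup : IsSemigroup _≃_ _+_
+-isSemigroup = record { isMagma = +-isMagma ; assoc = +-assoc }

+-isMonoid : IsMonoid _≃_ _+_ 0ℝ
+-isMonoid = record { isSemigroup = +-isSemigroup ; identity = +-identityˡ , +-identityʳ }

+-isGroup : IsGroup _≃_ _+_ 0ℝ (-_)
+-isGroup = record
  { isMonoid = +-isMonoid
  ; inverse  = -‿inverseˡ , -‿inverseʳ
  ; ⁻¹-cong  = λ {x} {y} x≃y → ≈⇒≃ (-‿cong {x} {y} x≃y .≃⇒≈)
  }

+-isAbelianGroup : IsAbelianGroup _≃_ _+_ 0ℝ (-_)
+-isAbelianGroup = record { isGroup = +-isGroup ; comm = +-comm }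

isRing : IsRing _≃_ _+_ _*_ (-_) 0ℝ 1ℝ
isRing = record
  { +-isAbelianGroup = +-isAbelianGroup
  ; *-cong           = λ {x} {y} {u} {v} → *-cong {x} {y} {u} {v}
  ; *-assoc          = *-assoc
  ; *-identity       = *-identityˡ , *-identityʳ
  ; distrib          = *-distribˡ-+ , *-distribʳ-+
  }

ℝ-commutativeRing : CommutativeRing 0ℓ 0ℓ
ℝ-commutativeRing = record
  { isCommutativeRing = record { isRing = isRing ; *-comm = *-comm } }

-- The terms of the product are 1 only from the index on where `x` stays above `δ`: earlier terms of
-- `x` may vanish, so `pointwise` does not apply.
x*x⁻¹≃1 : ∀ {x} (0<x : 0ℝ < x) → x * x ⁻¹⟨ 0<x ⟩ ≃ 1ℝ
x*x⁻¹≃1 {x} 0<x@(δ , 0<δ , _) = ≈⇒≃ λ ε 0<ε → eventually-map (λ n δ≤x →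
  subst (λ p → ∣ p ℚ.- 1ℚ ∣ ℚ.< ε) (sym (*-recip (ℚ.<-≤-trans 0<δ δ≤x))) (∣p-p∣<ε 1ℚ 0<ε))
  (pos⁻¹ {x} 0<x)

-- The order on ℝ

≃⇒≲ : ∀ {x y} → x ≃ y → x ≲ y
≃⇒≲ {x} {y} x≃y = ≤⇒≲ λ ε 0<ε →
  eventually-map (λ n h → ∣p-q∣≤c⇒p≤q+c (seq x n) (seq y n) (ℚ.<⇒≤ h)) (≃⇒≈ x≃y ε 0<ε)

≲-trans : ∀ {x y z} → x ≲ y → y ≲ z → x ≲ z
≲-trans {x} {y} {z} (≤⇒≲ x≤y) (≤⇒≲ y≤z) = ≤⇒≲ λ ε 0<ε → eventually-map (λ n (xy , yz) →
  subst (seq x n ℚ.≤_) (trans (ℚ.+-assoc (seq z n) _ _) (cong (seq z n ℚ.+_) (halves ε)))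
    (ℚ.≤-trans xy (ℚ.+-monoˡ-≤ (ε ℚ.* ½) yz)))
  (both (x≤y _ (0<½* 0<ε)) (y≤z _ (0<½* 0<ε)))

≲-preorder : Preorder 0ℓ 0ℓ 0ℓ
≲-preorder = record
  { Carrier = ℝ ; _≈_ = _≃_ ; _≲_ = _≲_
  ; isPreorder = record
    { isEquivalence = CommutativeRing.isEquivalence ℝ-commutativeRing
    ; reflexive = ≃⇒≲
    ; trans = ≲-trans
    }
  }

≲-refl : ∀ {x} → x ≲ x
≲-refl = ≃⇒≲ ≃-refl

+-mono-≲ : ∀ {x y u v} → x ≲ y → u ≲ v → x + u ≲ y + v
+-mono-≲ {x} {y} {u} {v} (≤⇒≲ x≤y) (≤⇒≲ u≤v) = ≤⇒≲ λ ε 0<ε → eventually-map (λ n (xy , uv) →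
  subst (seq x n ℚ.+ seq u n ℚ.≤_)
    (trans (solve 3 (λ y v e → (y :+ e) :+ (v :+ e) := (y :+ v) :+ (e :+ e)) refl
             (seq y n) (seq v n) (ε ℚ.* ½))
           (cong (seq y n ℚ.+ seq v n ℚ.+_) (halves ε)))
    (ℚ.+-mono-≤ xy uv))
  (both (x≤y _ (0<½* 0<ε)) (u≤v _ (0<½* 0<ε)))

-- From a ≥ -η and b ≥ -θ follows ab ≥ -(ηb + θ(a + η)); η and then θ are
-- chosen to make the error at most ε.
*-nonNeg : ∀ {a b} → 0ℝ ≲ a → 0ℝ ≲ b → 0ℝ ≲ a * b
*-nonNeg {a} {b} (≤⇒≲ 0≤a) (≤⇒≲ 0≤b) = ≤⇒≲ λ ε 0<ε →
  let
    A , 0<A , ∣a∣≤A = bounded (cauchy a)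
    B , 0<B , ∣b∣≤B = bounded (cauchy b)
    η , 0<η , Bη≡ε/2 = scale 0<B (0<½* 0<ε)
    θ , 0<θ , [A+η]θ≡ε/2 = scale (0<+ 0<A 0<η) (0<½* 0<ε)
  in eventually-map (λ n ((a≤A , b≤B) , (0≤a+η , 0≤b+θ)) →
    subst (λ e → 0ℚ ℚ.≤ seq a n ℚ.* seq b n ℚ.+ e)
      (trans (cong₂ ℚ._+_ Bη≡ε/2 [A+η]θ≡ε/2) (halves ε))
      (product (seq a n) (seq b n) A B η θ (ℚ.<⇒≤ 0<η) (ℚ.<⇒≤ 0<θ) 0≤a+η 0≤b+θ
        (ℚ.≤-trans (p≤∣p∣ (seq a n)) a≤A) (ℚ.≤-trans (p≤∣p∣ (seq b n)) b≤B)))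
    (both (both ∣a∣≤A ∣b∣≤B) (both (0≤a η 0<η) (0≤b θ 0<θ)))
  where
  open ℚ.≤-Reasoning
  product : ∀ a b A B η θ → 0ℚ ℚ.≤ η → 0ℚ ℚ.≤ θ → 0ℚ ℚ.≤ a ℚ.+ η → 0ℚ ℚ.≤ b ℚ.+ θ →
            a ℚ.≤ A → b ℚ.≤ B → 0ℚ ℚ.≤ a ℚ.* b ℚ.+ (B ℚ.* η ℚ.+ (A ℚ.+ η) ℚ.* θ)
  product a b A B η θ 0≤η 0≤θ 0≤a+η 0≤b+θ a≤A b≤B = begin
    0ℚ
      ≡⟨ ℚ.*-zeroʳ (a ℚ.+ η) ⟨
    (a ℚ.+ η) ℚ.* 0ℚ
      ≤⟨ ℚ.*-monoˡ-≤-nonNeg (a ℚ.+ η) {{ℚ.nonNegative 0≤a+η}} 0≤b+θ ⟩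
    (a ℚ.+ η) ℚ.* (b ℚ.+ θ)
      ≡⟨ solve 4 (λ a b η θ → (a :+ η) :* (b :+ θ) := a :* b :+ (b :* η :+ (a :+ η) :* θ))
           refl a b η θ ⟩
    a ℚ.* b ℚ.+ (b ℚ.* η ℚ.+ (a ℚ.+ η) ℚ.* θ)
      ≤⟨ ℚ.+-monoʳ-≤ (a ℚ.* b) (ℚ.+-mono-≤
           (ℚ.*-monoʳ-≤-nonNeg η {{ℚ.nonNegative 0≤η}} b≤B)
           (ℚ.*-monoʳ-≤-nonNeg θ {{ℚ.nonNegative 0≤θ}} (ℚ.+-monoˡ-≤ η a≤A))) ⟩
    a ℚ.* b ℚ.+ (B ℚ.* η ℚ.+ (A ℚ.+ η) ℚ.* θ) ∎

module ≲-Reasoning = PreorderReasoning ≲-preorder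

≲⇒0≲- : ∀ {x y} → x ≲ y → 0ℝ ≲ y + - x
≲⇒0≲- {x} {y} x≲y = begin
  0ℝ       ≈⟨ pointwise (λ n → sym (ℚ.+-inverseʳ (seq x n))) ⟩
  x + - x  ≲⟨ +-mono-≲ {x} {y} { - x} { - x} x≲y (≲-refl { - x}) ⟩
  y + - x  ∎
  where open ≲-Reasoning

0≲-⇒≲ : ∀ {x y} → 0ℝ ≲ y + - x → x ≲ y
0≲-⇒≲ {x} {y} 0≲y-x = begin
  x              ≈⟨ pointwise (λ n → sym (ℚ.+-identityˡ (seq x n))) ⟩
  0ℝ + x         ≲⟨ +-mono-≲ {0ℝ} {y + - x} {x} {x} 0≲y-x ≲-refl ⟩
  y + - x + x    ≈⟨ pointwise (λ n → solve 2 (λ x y → y :- x :+ x := y) refl (seq x n) (seq y n)) ⟩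
  y              ∎
  where open ≲-Reasoning

*-monoˡ-≲ : ∀ {c x y} → 0ℝ ≲ c → x ≲ y → c * x ≲ c * y
*-monoˡ-≲ {c} {x} {y} 0≲c x≲y = 0≲-⇒≲ {c * x} {c * y} (begin
  0ℝ                 ≲⟨ *-nonNeg {c} {y + - x} 0≲c (≲⇒0≲- x≲y) ⟩
  c * (y + - x)      ≈⟨ pointwise (λ n → solve 3 (λ c x y → c :* (y :- x) := c :* y :- c :* x) refl
                          (seq c n) (seq x n) (seq y n)) ⟩
  c * y + - (c * x)  ∎)
  where open ≲-Reasoning

*-monoʳ-≲ : ∀ {c x y} → 0ℝ ≲ c → x ≲ y → x * c ≲ y * c
*-monoʳ-≲ {c} {x} {y} 0≲c x≲y = begin
  x * c  ≈⟨ *-comm x c ⟩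
  c * x  ≲⟨ *-monoˡ-≲ {c} {x} {y} 0≲c x≲y ⟩
  c * y  ≈⟨ *-comm c y ⟩
  y * c  ∎
  where open ≲-Reasoning

fromℚ-mono : ∀ {p q} → p ℚ.≤ q → fromℚ p ≲ fromℚ q
fromℚ-mono {p} {q} p≤q = ≤⇒≲ λ ε 0<ε → 0 , λ _ _ →
  ℚ.≤-trans p≤q (subst (ℚ._≤ q ℚ.+ ε) (ℚ.+-identityʳ q) (ℚ.+-monoʳ-≤ q (ℚ.<⇒≤ 0<ε)))

-- A strict inequality carries a rational gap; this `δ` becomes the rate in Bernoulli's inequality.
<⇒≲ : ∀ {x p} → x < fromℚ p → ∃[ δ ] 0ℚ ℚ.< δ × x ≲ fromℚ (p ℚ.- δ)
<⇒≲ {x} {p} (δ , 0<δ , h) = δ , 0<δ , ≤⇒≲ λ ε 0<ε → eventually-map (λ n x+δ≤p →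
  p-q≤c⇒p≤q+c (ℚ.≤-trans (subst (seq x n ℚ.- (p ℚ.- δ) ℚ.≤_) (ℚ.+-inverseʳ p)
    (subst (ℚ._≤ p ℚ.- p) (solve 3 (λ x p d → (x :+ d) :- p := x :- (p :- d)) refl (seq x n) p δ)
      (ℚ.+-monoˡ-≤ (ℚ.- p) x+δ≤p))) (ℚ.<⇒≤ 0<ε))) h

-- Since `≲` bounds the terms only up to an arbitrarily small error, an extra `ε` is needed. Half of
-- it covers that error, the other half makes the final inequality strict.
squeeze-near : ∀ {x y δ ε} → 0ℚ ℚ.≤ δ → 0ℚ ℚ.< ε → x ≲ y → y ≲ x + fromℚ δ → x ≈[ δ ℚ.+ ε ] y
squeeze-near {x} {y} {δ} {ε} 0≤δ 0<ε (≤⇒≲ x≤y) (≤⇒≲ y≤x+δ) =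
  near (eventually-map (λ n (xy , yx) → ℚ.≤-<-trans
    (∣p-q∣≤c
      (ℚ.≤-trans xy (ℚ.+-monoʳ-≤ (seq y n)
        (subst (ℚ._≤ δ ℚ.+ ε ℚ.* ½) (ℚ.+-identityˡ (ε ℚ.* ½)) (ℚ.+-monoˡ-≤ (ε ℚ.* ½) 0≤δ))))
      (ℚ.≤-trans yx (ℚ.≤-reflexive (ℚ.+-assoc (seq x n) δ (ε ℚ.* ½)))))
    (ℚ.+-monoʳ-< δ ε/2<ε))
    (both (x≤y _ (0<½* 0<ε)) (y≤x+δ _ (0<½* 0<ε))))
  where
  ε/2<ε : ε ℚ.* ½ ℚ.< ε
  ε/2<ε = subst₂ ℚ._<_ (ℚ.+-identityˡ _) (halves ε) (ℚ.+-monoˡ-< (ε ℚ.* ½) (0<½* 0<ε))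

-- Limits

infix 4 _⟶_

-- Rational tolerances are enough; `⟶⇒HasSum` passes to the real ones in `HasSum`.
_⟶_ : (ℕ → ℝ) → ℝ → Set
f ⟶ x = ∀ ε → 0ℚ ℚ.< ε → Eventually λ n → f n ≈[ ε ] x

⟶-unique : ∀ {f x y} → f ⟶ x → f ⟶ y → x ≃ y
⟶-unique f⟶x f⟶y = near⇒≃ λ _ 0<ε →
  let N , h = both (f⟶x _ (0<½* 0<ε)) (f⟶y _ (0<½* 0<ε))
      fx , fy = h N ℕ.≤-refl
  in near-halves (near-trans (near-sym fx) fy)

⟶-cong : ∀ {f g x} → (∀ n → f n ≃ g n) → f ⟶ x → g ⟶ x
⟶-cong f≃g f⟶x ε 0<ε = eventually-map (λ n fx → near-halves
  (near-trans (≃⇒near (0<½* 0<ε) (≃-sym (f≃g n))) fx)) (f⟶x _ (0<½* 0<ε))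

⟶-tail : ∀ {f x} → f ⟶ x → (λ n → f (suc n)) ⟶ x
⟶-tail f⟶x ε 0<ε = let N , h = f⟶x ε 0<ε in N , λ n N≤n → h (suc n) (ℕ.m≤n⇒m≤1+n N≤n)

⟶-const : ∀ {x} → (λ _ → x) ⟶ x
⟶-const ε 0<ε = 0 , λ _ _ → ≃⇒near 0<ε ≃-refl

⟶-+ : ∀ {f g x y} → f ⟶ x → g ⟶ y → (λ n → f n + g n) ⟶ x + y
⟶-+ f⟶x g⟶y ε 0<ε = eventually-map (λ n (fx , gy) → near-halves (near-+ fx gy))
  (both (f⟶x _ (0<½* 0<ε)) (g⟶y _ (0<½* 0<ε)))

⟶-*ˡ : ∀ {f x} c → f ⟶ x → (λ n → c * f n) ⟶ c * x
⟶-*ˡ {f} {x} c f⟶x ε 0<ε = let δ , 0<δ , close = near-*ˡ c 0<ε in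
  eventually-map (λ n → close (f n) x) (f⟶x δ 0<δ)

⟶-≃ : ∀ {f x y} → x ≃ y → f ⟶ x → f ⟶ y
⟶-≃ x≃y f⟶x ε 0<ε = eventually-map (λ n fx → near-halves
  (near-trans fx (≃⇒near (0<½* 0<ε) x≃y))) (f⟶x _ (0<½* 0<ε))

⟶-*ʳ : ∀ {f x} c → f ⟶ x → (λ n → f n * c) ⟶ x * c
⟶-*ʳ {f} {x} c f⟶x = ⟶-≃ (*-comm c x) (⟶-cong (λ n → *-comm c (f n)) (⟶-*ˡ c f⟶x))

-- Completeness of the reals.

near-seq : ∀ x {ε} → 0ℚ ℚ.< ε → Eventually λ n → x ≈[ ε ] fromℚ (seq x n)
near-seq x 0<ε = let N , h = cauchy x _ 0<ε in
  N , λ n N≤n → near (N , λ m N≤m → h m n N≤m N≤n)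

fromℚ-near : ∀ {p q ε} → fromℚ p ≈[ ε ] fromℚ q → ∣ p ℚ.- q ∣ ℚ.< ε
fromℚ-near (near (N , h)) = h N ℕ.≤-refl

error : ℕ → ℚ
error n = recip (suc n ⨯ 1ℚ)

0<1+n : ∀ n → 0ℚ ℚ.< suc n ⨯ 1ℚ
0<1+n n = ℚ.<-≤-trans 0<1 (subst (ℚ._≤ suc n ⨯ 1ℚ) (ℚ.+-identityʳ 1ℚ) (ℚ.+-monoʳ-≤ 1ℚ (0≤n⨯1 n)))

0<error : ∀ n → 0ℚ ℚ.< error n
0<error n = recip-pos (0<1+n n)

error→0 : ∀ {ε} → 0ℚ ℚ.< ε → Eventually λ n → error n ℚ.≤ ε
error→0 {ε} 0<ε = let N , h = archimedean 0<ε in N , λ n N≤n →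
  ℚ.*-cancelˡ-≤-pos (suc n ⨯ 1ℚ) {{ℚ.positive (0<1+n n)}}
    (subst₂ ℚ._≤_ (sym (*-recip (0<1+n n))) (ℚ.*-comm ε (suc n ⨯ 1ℚ))
      (h (suc n) (ℕ.m≤n⇒m≤1+n N≤n)))

-- The `n`th term of the limit is a rational within `1/(n + 1)` of `f n`. As `∃` carries its
-- witness, selecting these rationals needs no choice principle.
module Completeness (f : ℕ → ℝ)
  (f-cauchy : ∀ ε → 0ℚ ℚ.< ε → ∃[ N ] ∀ m n → N ℕ.≤ m → N ℕ.≤ n → f m ≈[ ε ] f n) where

  approximation : ∀ n → ∃[ p ] f n ≈[ error n ] fromℚ p
  approximation n = let N , h = near-seq (f n) (0<error n) in
    seq (f n) N , h N ℕ.≤-refl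

  approx : ℕ → ℚ
  approx n = proj₁ (approximation n)

  -- The two indices are independent so that the estimate serves twice: for the Cauchy property of
  -- `approx`, comparing two of its terms through a single `f m`, and for the convergence of `f`.
  near-approx : ∀ ε → 0ℚ ℚ.< ε → ∃[ N ] ∀ m n → N ℕ.≤ m → N ℕ.≤ n → f m ≈[ ε ] fromℚ (approx n)
  near-approx ε 0<ε =
    let M , close = f-cauchy _ (0<½* 0<ε)
        N , small = error→0 (0<½* 0<ε)
    in M ℕ.⊔ N , λ m n hm hn → near-halves (near-trans
         (close m n (ℕ.≤-trans (ℕ.m≤m⊔n M N) hm) (ℕ.≤-trans (ℕ.m≤m⊔n M N) hn))
         (near-≤ (small n (ℕ.≤-trans (ℕ.m≤n⊔m M N) hn)) (proj₂ (approximation n))))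

  limit : ℝ
  limit = real approx λ ε 0<ε → let N , h = near-approx _ (0<½* 0<ε) in
    N , λ m n N≤m N≤n → fromℚ-near (near-halves
      (near-trans (near-sym (h m m N≤m N≤m)) (h m n N≤m N≤n)))

  f⟶limit : f ⟶ limit
  f⟶limit ε 0<ε =
    let M , h = near-approx _ (0<½* 0<ε)
        N , k = near-seq limit (0<½* 0<ε)
    -- `f m` is compared with `limit` through the rational `approx (M ⊔ N)`, whose index is late
    -- enough for both estimates.
    in M , λ m M≤m → near-halves (near-trans
         (h m (M ℕ.⊔ N) M≤m (ℕ.m≤m⊔n M N)) (near-sym (k (M ℕ.⊔ N) (ℕ.m≤n⊔m M N))))

near⇒≲ : ∀ {x y ε} → x ≈[ ε ] y → x ≲ y + fromℚ ε
near⇒≲ {x} {y} {ε} (near h) = ≤⇒≲ λ δ 0<δ → eventually-map (λ n xy →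
  ℚ.≤-trans (∣p-q∣≤c⇒p≤q+c (seq x n) (seq y n) (ℚ.<⇒≤ xy))
    (subst (ℚ._≤ seq y n ℚ.+ ε ℚ.+ δ) (ℚ.+-identityʳ _) (ℚ.+-monoʳ-≤ (seq y n ℚ.+ ε) (ℚ.<⇒≤ 0<δ)))) h

ascending : ∀ {f : ℕ → ℝ} → (∀ n → f n ≲ f (suc n)) → ∀ {m n} → m ℕ.≤ n → f m ≲ f n
ascending {f} up m≤n = go (ℕ.≤⇒≤′ m≤n)
  where
  go : ∀ {m n} → m ℕ.≤′ n → f m ≲ f n
  go ℕ.≤′-refl                = ≲-refl
  go (ℕ.≤′-step {n} m≤n) = ≲-trans (go m≤n) (up n)

descending : ∀ {f : ℕ → ℝ} → (∀ n → f (suc n) ≲ f n) → ∀ {m n} → m ℕ.≤ n → f n ≲ f m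
descending {f} down m≤n = go (ℕ.≤⇒≤′ m≤n)
  where
  go : ∀ {m n} → m ℕ.≤′ n → f n ≲ f m
  go ℕ.≤′-refl                = ≲-refl
  go (ℕ.≤′-step {n} m≤n) = ≲-trans (down n) (go m≤n)

nested-intervals : ∀ {f e : ℕ → ℝ} → (∀ n → f n ≲ f (suc n)) →
                   (∀ n → f (suc n) + e (suc n) ≲ f n + e n) →
                   (∀ n → 0ℝ ≲ e n) → e ⟶ 0ℝ → ∃[ x ] f ⟶ x
nested-intervals {f} {e} up down 0≲e e⟶0 = Completeness.limit f f-cauchy , Completeness.f⟶limit f f-cauchy
  where
  open ≲-Reasoning
  -- Since `e n` is nonnegative, `f n` lies below its own upper endpoint `f n + e n`, which has
  -- descended from `f m + e m`.
  above : ∀ {m n ε} → m ℕ.≤ n → e m ≈[ ε ] 0ℝ → f n ≲ f m + fromℚ ε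
  above {m} {n} {ε} m≤n em = begin
    f n                   ≈⟨ pointwise (λ k → sym (ℚ.+-identityʳ (seq (f n) k))) ⟩
    f n + 0ℝ              ≲⟨ +-mono-≲ {f n} {f n} {0ℝ} {e n} ≲-refl (0≲e n) ⟩
    f n + e n             ≲⟨ descending {λ k → f k + e k} down m≤n ⟩
    f m + e m             ≲⟨ +-mono-≲ {f m} {f m} {e m} {0ℝ + fromℚ ε} ≲-refl (near⇒≲ {e m} {0ℝ} em) ⟩
    f m + (0ℝ + fromℚ ε)  ≈⟨ pointwise (λ k → cong (seq (f m) k ℚ.+_) (ℚ.+-identityˡ ε)) ⟩
    f m + fromℚ ε         ∎
  close : ∀ {m n ε} → 0ℚ ℚ.< ε → m ℕ.≤ n → e m ≈[ ε ℚ.* ½ ] 0ℝ → f m ≈[ ε ] f n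
  close 0<ε m≤n em = near-halves (squeeze-near (ℚ.<⇒≤ (0<½* 0<ε)) (0<½* 0<ε)
    (ascending {f} up m≤n) (above m≤n em))
  f-cauchy : ∀ ε → 0ℚ ℚ.< ε → ∃[ N ] ∀ m n → N ℕ.≤ m → N ℕ.≤ n → f m ≈[ ε ] f n
  f-cauchy ε 0<ε = let N , small = e⟶0 _ (0<½* 0<ε) in
    N , λ m n N≤m N≤n → by-cases N small N≤m N≤n (ℕ.≤-total m n)
    where
    by-cases : ∀ N → (∀ n → N ℕ.≤ n → e n ≈[ ε ℚ.* ½ ] 0ℝ) → ∀ {m n} → N ℕ.≤ m → N ℕ.≤ n →
               m ℕ.≤ n ⊎ n ℕ.≤ m → f m ≈[ ε ] f n
    by-cases N small N≤m N≤n (inj₁ m≤n) = close 0<ε m≤n (small _ N≤m)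
    by-cases N small N≤m N≤n (inj₂ n≤m) = near-sym (close 0<ε n≤m (small _ N≤n))

-- Bernoulli's inequality for r ≤ 1 - δ, in the form rⁿ (1 + nδ) ≤ 1.
module Geometric {r : ℝ} (0≲r : 0ℝ ≲ r) (r<1 : r < 1ℝ) {w : ℕ → ℝ}
  (w₀≃1 : w 0 ≃ 1ℝ) (w₁₊ₙ≃r*wₙ : ∀ n → w (suc n) ≃ r * w n) where

  open ≲-Reasoning

  0≲w : ∀ n → 0ℝ ≲ w n
  0≲w zero = begin
    0ℝ   ≲⟨ fromℚ-mono (ℚ.<⇒≤ 0<1) ⟩
    1ℝ   ≈⟨ w₀≃1 ⟨
    w 0  ∎
  0≲w (suc n) = begin
    0ℝ         ≲⟨ *-nonNeg {r} {w n} 0≲r (0≲w n) ⟩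
    r * w n    ≈⟨ w₁₊ₙ≃r*wₙ n ⟨
    w (suc n)  ∎

  gap : ∃[ δ ] 0ℚ ℚ.< δ × r ≲ fromℚ (1ℚ ℚ.- δ)
  gap = <⇒≲ {r} {1ℚ} r<1

  δ : ℚ
  δ = proj₁ gap

  0<δ : 0ℚ ℚ.< δ
  0<δ = proj₁ (proj₂ gap)

  r≲1-δ : r ≲ fromℚ (1ℚ ℚ.- δ)
  r≲1-δ = proj₂ (proj₂ gap)

  growth : ℕ → ℚ
  growth n = 1ℚ ℚ.+ δ ℚ.* (n ⨯ 1ℚ)

  0≤δ*n : ∀ n → 0ℚ ℚ.≤ δ ℚ.* (n ⨯ 1ℚ)
  0≤δ*n n = subst (ℚ._≤ δ ℚ.* (n ⨯ 1ℚ)) (ℚ.*-zeroʳ δ)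
    (ℚ.*-monoˡ-≤-nonNeg δ {{ℚ.nonNegative (ℚ.<⇒≤ 0<δ)}} (0≤n⨯1 n))

  δ*n≤growth : ∀ n → δ ℚ.* (n ⨯ 1ℚ) ℚ.≤ growth n
  δ*n≤growth n = subst (ℚ._≤ growth n) (ℚ.+-identityˡ _)
    (ℚ.+-monoˡ-≤ (δ ℚ.* (n ⨯ 1ℚ)) (ℚ.<⇒≤ 0<1))

  0≤growth : ∀ n → 0ℚ ℚ.≤ growth n
  0≤growth n = ℚ.≤-trans (0≤δ*n n) (δ*n≤growth n)

  -- The product expands to `growth n` minus `δ * δ * (n + 1)`.
  [1-δ]*growth≤growth : ∀ n → (1ℚ ℚ.- δ) ℚ.* growth (suc n) ℚ.≤ growth n
  [1-δ]*growth≤growth n = subst₂ ℚ._≤_ (sym (expand δ (n ⨯ 1ℚ))) (ℚ.+-identityʳ (growth n))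
    (ℚ.+-monoʳ-≤ (growth n) (ℚ.neg-antimono-≤ 0≤square))
    where
    0≤square : 0ℚ ℚ.≤ δ ℚ.* (δ ℚ.* (suc n ⨯ 1ℚ))
    0≤square = subst (ℚ._≤ δ ℚ.* (δ ℚ.* (suc n ⨯ 1ℚ))) (ℚ.*-zeroʳ δ)
      (ℚ.*-monoˡ-≤-nonNeg δ {{ℚ.nonNegative (ℚ.<⇒≤ 0<δ)}} (0≤δ*n (suc n)))
    expand : ∀ d m → (1ℚ ℚ.- d) ℚ.* (1ℚ ℚ.+ d ℚ.* (1ℚ ℚ.+ m)) ≡
                     1ℚ ℚ.+ d ℚ.* m ℚ.- d ℚ.* (d ℚ.* (1ℚ ℚ.+ m))
    expand = solve 2 (λ d m → (con 1ℚ :- d) :* (con 1ℚ :+ d :* (con 1ℚ :+ m)) :=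
                              con 1ℚ :+ d :* m :- d :* (d :* (con 1ℚ :+ m))) refl

  rational-step : ∀ n → fromℚ (1ℚ ℚ.- δ) * fromℚ (growth (suc n)) ≲ fromℚ (growth n)
  rational-step n = begin
    fromℚ (1ℚ ℚ.- δ) * fromℚ (growth (suc n))  ≈⟨ pointwise (λ _ → refl) ⟩
    fromℚ ((1ℚ ℚ.- δ) ℚ.* growth (suc n))      ≲⟨ fromℚ-mono ([1-δ]*growth≤growth n) ⟩
    fromℚ (growth n)                           ∎

  w*growth-antitone : ∀ n → w (suc n) * fromℚ (growth (suc n)) ≲ w n * fromℚ (growth n)
  w*growth-antitone n = begin
    w (suc n) * fromℚ (growth (suc n))
      ≈⟨ *-cong {w (suc n)} {r * w n} {fromℚ (growth (suc n))} {fromℚ (growth (suc n))}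
           (w₁₊ₙ≃r*wₙ n) ≃-refl ⟩
    r * w n * fromℚ (growth (suc n))
      ≈⟨ pointwise (λ k → solve 3 (λ r w g → r :* w :* g := w :* (r :* g)) refl
           (seq r k) (seq (w n) k) (growth (suc n))) ⟩
    w n * (r * fromℚ (growth (suc n)))
      ≲⟨ *-monoˡ-≲ {w n} {r * fromℚ (growth (suc n))} {fromℚ (1ℚ ℚ.- δ) * fromℚ (growth (suc n))}
           (0≲w n) (*-monoʳ-≲ {fromℚ (growth (suc n))} {r} {fromℚ (1ℚ ℚ.- δ)}
             (fromℚ-mono (0≤growth (suc n))) r≲1-δ) ⟩
    w n * (fromℚ (1ℚ ℚ.- δ) * fromℚ (growth (suc n)))
      ≲⟨ *-monoˡ-≲ {w n} {fromℚ (1ℚ ℚ.- δ) * fromℚ (growth (suc n))} {fromℚ (growth n)}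
           (0≲w n) (rational-step n) ⟩
    w n * fromℚ (growth n) ∎

  w₀*growth₀≃1 : w zero * fromℚ (growth zero) ≃ 1ℝ * 1ℝ
  w₀*growth₀≃1 = *-cong {w zero} {1ℝ} {fromℚ (growth zero)} {1ℝ} w₀≃1
    (pointwise λ _ → cong (1ℚ ℚ.+_) (ℚ.*-zeroʳ δ))

  w*growth≲1 : ∀ n → w n * fromℚ (growth n) ≲ 1ℝ
  w*growth≲1 zero    = ≲-trans (≃⇒≲ w₀*growth₀≃1) (≃⇒≲ (*-identityˡ 1ℝ))
  w*growth≲1 (suc n) = ≲-trans (w*growth-antitone n) (w*growth≲1 n)

  -- As `growth n` is at least `δ * n`, the hypothesis makes `ε * growth n` at least 1. Multiplying
  -- by this number replaces a division by `growth n`.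
  w-small : ∀ ε n → 0ℚ ℚ.< ε → 1ℚ ℚ.≤ ε ℚ.* δ ℚ.* (n ⨯ 1ℚ) → w n ≲ 0ℝ + fromℚ ε
  w-small ε n 0<ε h = begin
    w n                                 ≈⟨ *-identityʳ (w n) ⟨
    w n * 1ℝ                            ≲⟨ *-monoˡ-≲ {w n} {1ℝ} {fromℚ (ε ℚ.* growth n)} (0≲w n)
                                             (fromℚ-mono 1≤ε*growth) ⟩
    w n * fromℚ (ε ℚ.* growth n)        ≈⟨ pointwise (λ k → solve 3 (λ w e g → w :* (e :* g) := e :* (w :* g))
                                             refl (seq (w n) k) ε (growth n)) ⟩
    fromℚ ε * (w n * fromℚ (growth n))  ≲⟨ *-monoˡ-≲ {fromℚ ε} {w n * fromℚ (growth n)} {1ℝ}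
                                             (fromℚ-mono (ℚ.<⇒≤ 0<ε)) (w*growth≲1 n) ⟩
    fromℚ ε * 1ℝ                        ≈⟨ *-identityʳ (fromℚ ε) ⟩
    fromℚ ε                             ≈⟨ +-identityˡ (fromℚ ε) ⟨
    0ℝ + fromℚ ε                        ∎
    where
    1≤ε*growth : 1ℚ ℚ.≤ ε ℚ.* growth n
    1≤ε*growth = ℚ.≤-trans h (ℚ.≤-trans (ℚ.≤-reflexive (ℚ.*-assoc ε δ (n ⨯ 1ℚ)))
      (ℚ.*-monoˡ-≤-nonNeg ε {{ℚ.nonNegative (ℚ.<⇒≤ 0<ε)}} (δ*n≤growth n)))

  w⟶0 : w ⟶ 0ℝ
  w⟶0 ε 0<ε = eventually-map (λ n h → near-sym (near-halves
      (squeeze-near (ℚ.<⇒≤ (0<½* 0<ε)) (0<½* 0<ε) (0≲w n) (w-small (ε ℚ.* ½) n (0<½* 0<ε) h))))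
    (archimedean (0<* (0<½* 0<ε) 0<δ))

-- The reals as a complete ordered ring, and sums of series.

𝓡 : CompleteOrderedRing
𝓡 = record
  { commutativeRing  = ℝ-commutativeRing
  ; _≲_              = _≲_
  ; ≲-isPreorder     = Preorder.isPreorder ≲-preorder
  ; 0≲1              = fromℚ-mono (ℚ.<⇒≤ 0<1)
  ; +-mono-≲         = λ {x} {y} {u} {v} → +-mono-≲ {x} {y} {u} {v}
  ; *-monoˡ-≲        = λ {c} {x} {y} → *-monoˡ-≲ {c} {x} {y}
  ; _⟶_              = _⟶_
  ; ⟶-unique         = ⟶-unique
  ; ⟶-cong           = ⟶-cong
  ; ⟶-tail           = ⟶-tail
  ; ⟶-const          = ⟶-const
  ; ⟶-+              = λ {f} {g} {x} {y} → ⟶-+ {f} {g} {x} {y}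
  ; ⟶-*ˡ             = λ {f} {x} → ⟶-*ˡ {f} {x}
  ; ⟶-*ʳ             = λ {f} {x} → ⟶-*ʳ {f} {x}
  ; nested-intervals = λ {f} {e} → nested-intervals {f} {e}
  }

module ∑ = SemiringSum (CommutativeRing.semiring ℝ-commutativeRing)

sum-cong : ∀ {m} {f g : Fin m → ℝ} → (∀ k → f k ≃ g k) → sum f ≃ sum g
sum-cong {m} {f} {g} f≃g = ∑.sum-cong-≋ {m} {f} {g} f≃g

-- The proof that the real `ε` is positive contains a rational `δ` that eventually lies below it.
-- Half of `δ` bounds the distance from the partial sum to `s`; the other half witnesses the strict
-- inequalities.
⟶⇒HasSum : ∀ {f s} → (λ N → sum {N} λ k → f (toℕ k)) ⟶ s → HasSum f s
⟶⇒HasSum {f} {s} S⟶s ε 0<ε@(δ , 0<δ , _) = eventually-map (λ N S≈s → below N S≈s , above N S≈s)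
  (S⟶s (δ ℚ.* ½) (0<½* 0<δ))
  where
  S : ℕ → ℝ
  S N = sum {N} λ k → f (toℕ k)
  regroup : ∀ x → x ℚ.+ δ ℚ.* ½ ℚ.+ δ ℚ.* ½ ≡ x ℚ.+ δ
  regroup x = trans (ℚ.+-assoc x _ _) (cong (x ℚ.+_) (halves δ))
  below : ∀ N → S N ≈[ δ ℚ.* ½ ] s → s - ε < S N
  below N (near h) = δ ℚ.* ½ , 0<½* 0<δ , eventually-map (λ n (S≈s , δ≤ε) →
    lower (seq s n) (seq (S N) n) (seq ε n) δ≤ε
      (∣p-q∣≤c⇒p≤q+c (seq s n) (seq (S N) n)
        (ℚ.<⇒≤ (subst (ℚ._< δ ℚ.* ½) (∣p-q∣≡∣q-p∣ (seq (S N) n) (seq s n)) S≈s))))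
    (both h (pos⁻¹ {ε} 0<ε))
    where
    open ℚ.≤-Reasoning
    lower : ∀ s S ε → δ ℚ.≤ ε → s ℚ.≤ S ℚ.+ δ ℚ.* ½ → s ℚ.- ε ℚ.+ δ ℚ.* ½ ℚ.≤ S
    lower s S ε δ≤ε s≤S+δ/2 = begin
      s ℚ.- ε ℚ.+ δ ℚ.* ½
        ≤⟨ ℚ.+-monoˡ-≤ (δ ℚ.* ½) (ℚ.+-mono-≤ s≤S+δ/2 (ℚ.neg-antimono-≤ δ≤ε)) ⟩
      S ℚ.+ δ ℚ.* ½ ℚ.- δ ℚ.+ δ ℚ.* ½
        ≡⟨ solve 3 (λ S h d → S :+ h :- d :+ h := S :+ h :+ h :- d) refl S (δ ℚ.* ½) δ ⟩
      S ℚ.+ δ ℚ.* ½ ℚ.+ δ ℚ.* ½ ℚ.- δ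
        ≡⟨ cong (ℚ._- δ) (regroup S) ⟩
      S ℚ.+ δ ℚ.- δ
        ≡⟨ solve 2 (λ S d → S :+ d :- d := S) refl S δ ⟩
      S ∎
  above : ∀ N → S N ≈[ δ ℚ.* ½ ] s → S N < s + ε
  above N (near h) = δ ℚ.* ½ , 0<½* 0<δ , eventually-map (λ n (S≈s , δ≤ε) →
    upper (seq s n) (seq (S N) n) (seq ε n) δ≤ε
      (∣p-q∣≤c⇒p≤q+c (seq (S N) n) (seq s n) (ℚ.<⇒≤ S≈s)))
    (both h (pos⁻¹ {ε} 0<ε))
    where
    open ℚ.≤-Reasoning
    upper : ∀ s S ε → δ ℚ.≤ ε → S ℚ.≤ s ℚ.+ δ ℚ.* ½ → S ℚ.+ δ ℚ.* ½ ℚ.≤ s ℚ.+ ε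
    upper s S ε δ≤ε S≤s+δ/2 = begin
      S ℚ.+ δ ℚ.* ½              ≤⟨ ℚ.+-monoˡ-≤ (δ ℚ.* ½) S≤s+δ/2 ⟩
      s ℚ.+ δ ℚ.* ½ ℚ.+ δ ℚ.* ½  ≡⟨ regroup s ⟩
      s ℚ.+ δ                    ≤⟨ ℚ.+-monoʳ-≤ s δ≤ε ⟩
      s ℚ.+ ε                    ∎

-- Probabilities of the observed states.

open GeometricObservation
  using (trialsWeight; pathWeight; weight; sumVec; observedAt?; IsTransitionMatrix)
open MarkovChain using (P)
open Matrices using (𝟙; power)

-- Modules are used here by qualified names and not opened with arguments, since
-- the copies made by the latter are not syntactically equal to the originals.
module PathProbabilities {n} (C : MarkovChain n) (S : SuccessProbability) where

  pathWeight≃ : ∀ {k} (xs : Vec (Fin n) (suc k)) →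
                pathWeight C S xs ≃ Matrices.Paths.pathWeight 𝓡 n (P C) xs
  pathWeight≃ (x ∷ [])     = ≈⇒≃ (≃-refl {1ℝ} .≃⇒≈)
  pathWeight≃ (x ∷ y ∷ xs) = ≈⇒≃ (*-congˡ {P C x y} {pathWeight C S (y ∷ xs)}
    {Matrices.Paths.pathWeight 𝓡 n (P C) (y ∷ xs)} (pathWeight≃ (y ∷ xs)) .≃⇒≈)

  sumVec≃ : ∀ k {f g : Vec (Fin n) k → ℝ} → (∀ xs → f xs ≃ g xs) →
            sumVec C S k f ≃ Matrices.Paths.sumVec 𝓡 n (P C) k g
  sumVec≃ zero    f≃g = f≃g []
  sumVec≃ (suc k) {f} {g} f≃g = ≈⇒≃ (sum-cong {n} {λ x → sumVec C S k λ xs → f (x ∷ xs)}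
    {λ x → Matrices.Paths.sumVec 𝓡 n (P C) k λ xs → g (x ∷ xs)}
    (λ x → sumVec≃ k λ xs → f≃g (x ∷ xs)) .≃⇒≈)

  headWeight≃ : ∀ i {k} (xs : Vec (Fin n) (suc k)) →
    𝕀 i (head xs) * pathWeight C S xs ≃
    𝟙 𝓡 n i (head xs) * Matrices.Paths.pathWeight 𝓡 n (P C) xs
  headWeight≃ i xs = ≈⇒≃ (*-congˡ {𝕀 i (head xs)} {pathWeight C S xs}
    {Matrices.Paths.pathWeight 𝓡 n (P C) xs} (pathWeight≃ xs) .≃⇒≈)

  weight≃ : ∀ i k xs →
    weight C S i (k , xs) ≃ Matrices.Paths.outcomeWeight 𝓡 n (P C) (trialsWeight C S k) i xs
  weight≃ i k xs = ≈⇒≃ (*-congˡ {trialsWeight C S k} {𝕀 i (head xs) * pathWeight C S xs}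
    {𝟙 𝓡 n i (head xs) * Matrices.Paths.pathWeight 𝓡 n (P C) xs} (headWeight≃ i xs) .≃⇒≈)

  -- The test is replaced by a variable `b`, so that the case split does not involve `Fin.≟`.
  if-weight≃ : ∀ b i k xs →
    (if b then weight C S i (k , xs) else 0ℝ) ≃
    (if b then Matrices.Paths.outcomeWeight 𝓡 n (P C) (trialsWeight C S k) i xs else 0ℝ)
  if-weight≃ true  i k xs = weight≃ i k xs
  if-weight≃ false i k xs = ≃-refl

  observed : Fin n → Fin n → ∀ k → Vec (Fin n) (suc k) → ℝ
  observed i j k xs = if does (observedAt? C S j (k , xs)) then weight C S i (k , xs) else 0ℝ

  observed≃ : ∀ i j k xs →
    observed i j k xs ≃ Matrices.Paths.observed 𝓡 n (P C) (trialsWeight C S k) i j xs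
  observed≃ i j k xs = if-weight≃ (does (last xs Fin.≟ j)) i k xs

  sumVec-observed≃ : ∀ i j k →
    sumVec C S (suc k) (observed i j k) ≃
    Matrices.Paths.sumVec 𝓡 n (P C) (suc k)
      (Matrices.Paths.observed 𝓡 n (P C) (trialsWeight C S k) i j)
  sumVec-observed≃ i j k = sumVec≃ (suc k) {observed i j k}
    {Matrices.Paths.observed 𝓡 n (P C) (trialsWeight C S k) i j} (observed≃ i j k)

  observed-sum : ∀ i j k →
    sumVec C S (suc k) (observed i j k) ≃ trialsWeight C S k * power 𝓡 n (P C) k i j
  observed-sum i j k = ≃-trans (sumVec-observed≃ i j k)
    (≈⇒≃ (Matrices.Paths.observed-sum 𝓡 n (P C) (trialsWeight C S k) i j k .≃⇒≈))

-- The success probability and its parameters.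

0<⇒0≲ : ∀ {x} → 0ℝ < x → 0ℝ ≲ x
0<⇒0≲ {x} 0<x@(δ , 0<δ , _) = ≤⇒≲ λ ε 0<ε → eventually-map (λ n δ≤x →
  ℚ.≤-trans (ℚ.<⇒≤ 0<δ) (ℚ.≤-trans δ≤x (subst (ℚ._≤ seq x n ℚ.+ ε) (ℚ.+-identityʳ (seq x n))
    (ℚ.+-monoʳ-≤ (seq x n) (ℚ.<⇒≤ 0<ε))))) (pos⁻¹ {x} 0<x)

x<1⇒0<1-x : ∀ {x} → x < 1ℝ → 0ℝ < 1ℝ - x
x<1⇒0<1-x {x} (δ , 0<δ , h) = pos {1ℝ - x} 0<δ (eventually-map (λ n x+δ≤1 →
  subst (ℚ._≤ 1ℚ ℚ.- seq x n) (solve 2 (λ x d → x :+ d :- x := d) refl (seq x n) δ)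
    (ℚ.+-monoˡ-≤ (ℚ.- seq x n) x+δ≤1)) h)

0<x⇒1-x<1 : ∀ {x} → 0ℝ < x → 1ℝ - x < 1ℝ
0<x⇒1-x<1 {x} 0<x@(δ , 0<δ , _) = δ , 0<δ , eventually-map (λ n δ≤x →
  subst (1ℚ ℚ.- seq x n ℚ.+ δ ℚ.≤_) (solve 2 (λ o x → o :- x :+ x := o) refl 1ℚ (seq x n))
    (ℚ.+-monoʳ-≤ (1ℚ ℚ.- seq x n) δ≤x)) (pos⁻¹ {x} 0<x)

x+[1-x]≃1 : ∀ x → x + (1ℝ - x) ≃ 1ℝ
x+[1-x]≃1 x = pointwise λ n → solve 2 (λ x o → x :+ (o :- x) := o) refl (seq x n) 1ℚ

^-suc-≃ : ∀ x n → x ^ suc n ≃ x * x ^ n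
^-suc-≃ x n = ≈⇒≃ (≃-refl {x ^ suc n} .≃⇒≈)

-- The reciprocal of y in successProbability is formed from another proof of
-- 0 < y, which does not affect its rational approximations.
module Parameters (τ : ℝ) (0<τ : 0ℝ < τ) (α : ℝ) (0<α : 0ℝ < α) where

  t y q : ℝ
  t = τ / α ⟨ 0<α ⟩
  y = t + 1ℝ
  q = SuccessProbability.q (successProbability τ 0<τ α 0<α)

  0<y : 0ℝ < y
  0<y = 1<⇒0< {y} (<+1 {t} (*-pos {τ} {α ⁻¹⟨ 0<α ⟩} 0<τ (⁻¹-pos {α} 0<α)))

  y*q≃1 : y * q ≃ 1ℝ
  y*q≃1 = ≈⇒≃ (x*x⁻¹≃1 {y} 0<y .≃⇒≈)

  -- The product is `y - y * q`, that is `(t + 1) - 1`.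
  y*[1-q]≃t : y * (1ℝ - q) ≃ t
  y*[1-q]≃t = ≃-trans (pointwise λ n → expand (seq y n) (seq q n))
    (≃-trans (+-cong {y} {y} { - (y * q)} { - 1ℝ} ≃-refl (-‿cong {y * q} {1ℝ} y*q≃1))
      (pointwise λ n → solve 2 (λ t o → t :+ o :- o := t) refl (seq t n) 1ℚ))
    where
    expand : ∀ y q → y ℚ.* (1ℚ ℚ.- q) ≡ y ℚ.- y ℚ.* q
    expand = solve 2 (λ y q → y :* (con 1ℚ :- q) := y :- y :* q) refl

  α*α⁻¹≃1 : α * α ⁻¹⟨ 0<α ⟩ ≃ 1ℝ
  α*α⁻¹≃1 = x*x⁻¹≃1 {α} 0<α

  -- One entry of `(I + τL) + (τ/α) P = (τ/α + 1) I`: the terms in `l` cancel because `(τ/α) α` is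
  -- `τ`.
  affine : ∀ {e l p} → p ≃ e - α * l → e + τ * l + t * p ≃ y * e
  affine {e} {l} {p} p≃e-αl = ≃-trans
    (+-cong {e + τ * l} {e + τ * l} {t * p} {t * (e - α * l)} ≃-refl (*-congˡ {t} {p} {e - α * l} p≃e-αl))
    -- The inverse law for `α` holds only up to `≃`, not term by term. The polynomial identity
    -- therefore isolates the defect `1 - α * α⁻¹` as a factor, which is then replaced by `1 - 1`.
    (≃-trans (pointwise λ n → expand (seq e n) (seq l n) (seq τ n) (seq α n) (seq (α ⁻¹⟨ 0<α ⟩) n))
    (≃-trans (+-cong {y * e} {y * e} {(1ℝ - α * α ⁻¹⟨ 0<α ⟩) * (τ * l)} {(1ℝ - 1ℝ) * (τ * l)} ≃-refl
       (*-cong {1ℝ - α * α ⁻¹⟨ 0<α ⟩} {1ℝ - 1ℝ} {τ * l} {τ * l}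
         (+-cong {1ℝ} {1ℝ} { - (α * α ⁻¹⟨ 0<α ⟩)} { - 1ℝ} ≃-refl
           (-‿cong {α * α ⁻¹⟨ 0<α ⟩} {1ℝ} α*α⁻¹≃1)) ≃-refl))
    (pointwise λ n → solve 3 (λ ye u o → ye :+ (o :- o) :* u := ye) refl (seq (y * e) n) (seq (τ * l) n) 1ℚ)))
    where
    expand : ∀ e l τ α β → e ℚ.+ τ ℚ.* l ℚ.+ τ ℚ.* β ℚ.* (e ℚ.- α ℚ.* l) ≡
                           (τ ℚ.* β ℚ.+ 1ℚ) ℚ.* e ℚ.+ (1ℚ ℚ.- α ℚ.* β) ℚ.* (τ ℚ.* l)
    expand = solve 5 (λ e l τ α β → e :+ τ :* l :+ τ :* β :* (e :- α :* l) :=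
                                    (τ :* β :+ con 1ℚ) :* e :+ (con 1ℚ :- α :* β) :* (τ :* l)) refl

-- From the abstract series to the chain.

^-nonNeg : ∀ {r} → 0ℝ ≲ r → r < 1ℝ → ∀ k → 0ℝ ≲ r ^ k
^-nonNeg {r} 0≲r r<1 = Geometric.0≲w {r} 0≲r r<1 {r ^_} (≈⇒≃ (≃-refl {1ℝ} .≃⇒≈))
  λ k → ≈⇒≃ (^-suc-≃ r k .≃⇒≈)

^⟶0 : ∀ {r} → 0ℝ ≲ r → r < 1ℝ → (r ^_) ⟶ 0ℝ
^⟶0 {r} 0≲r r<1 = Geometric.w⟶0 {r} 0≲r r<1 {r ^_} (≈⇒≃ (≃-refl {1ℝ} .≃⇒≈))
  λ k → ≈⇒≃ (^-suc-≃ r k .≃⇒≈)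

-- Translates the abstract result to the relations of the statement. The parameters stay variables
-- here, so the conversion checks do not meet concrete powers and reciprocals.
chain-series : ∀ {n} (C : MarkovChain n) (q r : ℝ) → 0ℝ ≲ q → q + r ≃ 1ℝ →
  (w : ℕ → ℝ) → w zero ≃ 1ℝ → (∀ k → w (suc k) ≃ r * w k) → (∀ k → 0ℝ ≲ w k) → w ⟶ 0ℝ →
  (c : ℕ → ℝ) → (∀ k → c k ≃ q * w k) →
  ∀ A y t → (∀ i j → A i j + t * P C i j ≃ y * 𝕀 i j) → y * q ≃ 1ℝ → y * r ≃ t →
  ∃[ Q ] Q IsInverseOf A ×
         (∀ i j → (λ m → sum {m} λ k → c (toℕ k) * power 𝓡 n (P C) (toℕ k) i j) ⟶ Q i j)
chain-series {n} C q r 0≲q q+r≃1 w w₀≃1 w-suc 0≲w w⟶0 c c≃qw A y t A+tP≃y y*q≃1 y*r≃t =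
  let Q , S⟶Q , AQ≃𝟙 , QA≃𝟙 = Matrices.NeumannSeries.neumann-series 𝓡 n {P C}
        (λ i j → ≤⇒≲ (MarkovChain.P≥0 C i j)) (λ i → ≈⇒≃ (MarkovChain.row-sum C i))
        {q} {r} 0≲q q+r≃1 {w} w₀≃1 w-suc 0≲w w⟶0 {c} c≃qw {A} {y} {t}
        (Matrices.entrywise λ i j → ≈⇒≃ (A+tP≃y i j .≃⇒≈)) y*q≃1 y*r≃t
  in Q
   , ((λ i j → Matrices.entry AQ≃𝟙 i j .≃⇒≈) , (λ i j → Matrices.entry QA≃𝟙 i j .≃⇒≈))
   , S⟶Q

module Observation {n : ℕ} (C : MarkovChain n) (S : SuccessProbability) where
  open SuccessProbability using (q)

  powerTerm observedTerm : Fin n → Fin n → ℕ → ℝ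
  powerTerm    i j k = trialsWeight C S k * power 𝓡 n (P C) k i j
  observedTerm i j k = sumVec C S (suc k) (PathProbabilities.observed C S i j k)

  observed≃power : ∀ i j k → observedTerm i j k ≃ powerTerm i j k
  observed≃power i j k = PathProbabilities.observed-sum C S i j k

  power≃observed : ∀ i j k → powerTerm i j k ≃ observedTerm i j k
  power≃observed i j k = ≃-sym {observedTerm i j k} {powerTerm i j k} (observed≃power i j k)

  partial-sums : ∀ i j m →
    sum {m} (λ k → powerTerm i j (toℕ k)) ≃ sum {m} (λ k → observedTerm i j (toℕ k))
  partial-sums i j m = sum-cong {m} {λ k → powerTerm i j (toℕ k)} {λ k → observedTerm i j (toℕ k)}
    λ k → power≃observed i j (toℕ k)

  isTransitionMatrix : ∀ Q → (∀ i j → (λ m → sum {m} λ k → powerTerm i j (toℕ k)) ⟶ Q i j) →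
                       IsTransitionMatrix C S Q
  isTransitionMatrix Q S⟶Q i j = ⟶⇒HasSum {observedTerm i j} {Q i j}
    (⟶-cong {λ m → sum {m} λ k → powerTerm i j (toℕ k)}
      {λ m → sum {m} λ k → observedTerm i j (toℕ k)} (partial-sums i j) (S⟶Q i j))

  0≲1-q : 0ℝ ≲ 1ℝ - q S
  0≲1-q = 0<⇒0≲ {1ℝ - q S} (x<1⇒0<1-x {q S} (SuccessProbability.q<1 S))

  1-q<1 : 1ℝ - q S < 1ℝ
  1-q<1 = 0<x⇒1-x<1 {q S} (SuccessProbability.0<q S)

  trialsWeight≃ : ∀ k → trialsWeight C S k ≃ q S * (1ℝ - q S) ^ k
  trialsWeight≃ k = ≈⇒≃ (≃-refl {trialsWeight C S k} .≃⇒≈)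

  inverse-isTransitionMatrix : ∀ A y t → (∀ i j → A i j + t * P C i j ≃ y * 𝕀 i j) →
    y * q S ≃ 1ℝ → y * (1ℝ - q S) ≃ t → ∃[ Q ] Q IsInverseOf A × IsTransitionMatrix C S Q
  inverse-isTransitionMatrix A y t A+tP≃y y*q≃1 y*r≃t =
    let Q , Q-inverse , S⟶Q = chain-series C (q S) (1ℝ - q S)
          (0<⇒0≲ {q S} (SuccessProbability.0<q S)) (≈⇒≃ (x+[1-x]≃1 (q S) .≃⇒≈))
          (λ k → (1ℝ - q S) ^ k) (≈⇒≃ (≃-refl {1ℝ} .≃⇒≈))
          (λ k → ≈⇒≃ (^-suc-≃ (1ℝ - q S) k .≃⇒≈))
          (^-nonNeg {1ℝ - q S} 0≲1-q 1-q<1) (^⟶0 {1ℝ - q S} 0≲1-q 1-q<1)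
          (trialsWeight C S) (λ k → ≈⇒≃ (trialsWeight≃ k .≃⇒≈)) A y t A+tP≃y y*q≃1 y*r≃t
    in Q , Q-inverse , isTransitionMatrix Q S⟶Q

-- A two-sided inverse is unique and a series has at most one sum, so a single `Q` with both
-- properties expresses the equality of the two matrices.
theorem6 :
    ∀ (n : ℕ) → 1 ℕ.< n →
    (Γ : WeightedDigraph n) →
    (τ : ℝ) (0<τ : 0ℝ < τ) →
    (C : MarkovChain n) →
    (α : ℝ) (0<α : 0ℝ < α) → Related Γ α C →
    ∃[ Q ] IsNormalizedForestMatrix Γ τ Q
         × GeometricObservation.IsTransitionMatrix C (successProbability τ 0<τ α 0<α) Q
theorem6 n _ Γ τ 0<τ C α 0<α related =
  Observation.inverse-isTransitionMatrix C (successProbability τ 0<τ α 0<α)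
    (𝕀 +ᴹ τ ·ᴹ kirchhoff Γ) (Parameters.y τ 0<τ α 0<α) (Parameters.t τ 0<τ α 0<α)
    (λ i j → ≈⇒≃ (Parameters.affine τ 0<τ α 0<α {𝕀 i j} {kirchhoff Γ i j} {P C i j}
      (≈⇒≃ (related i j)) .≃⇒≈))
    (≈⇒≃ (Parameters.y*q≃1 τ 0<τ α 0<α .≃⇒≈)) (≈⇒≃ (Parameters.y*[1-q]≃t τ 0<τ α 0<α .≃⇒≈))
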